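{- Let $G$ be a bipartite connected graph with $n \geq 4$ vertices and $m \geq n$ edges. Then $$Sz(G)-W(G) \geq 4n-8.$$ Equality holds if and only if $G$ is composed of a cycle $C_4$ on $4$ vertices and a tree $T$ on $n-3$ vertices sharing a single vertex.
   Context: All graphs are finite, undirected and simple. For a connected graph $G$, $d_G(u,v)$ is the distance between $u$ and $v$ in $G$, and the Wiener index is $W(G)=\sum_{\{u,v\}\subseteq V(G)} d_G(u,v)$ (sum over unordered pairs of distinct vertices). For an edge $e=uv$ let $n_u(e)=|\{w\in V(G): d_G(u,w)<d_G(v,w)\}|$ and $n_v(e)=|\{w\in V(G): d_G(v,w)<d_G(u,w)\}|$. The Szeged index is $Sz(G)=\sum_{e=uv\in E(G)} n_u(e)n_v(e)$. "A cycle and a tree sharing a single vertex" means that $G$ is the union of the cycle and the tree, which have exactly one vertex (and no edge) in common; the tree may be a single vertex. -}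

module Defs where

open import Data.Bool.Base using (Bool)
open import Data.Fin.Base using (Fin; toℕ)
open import Data.Fin.Properties using (_≟_; _<?_; any?)
open import Data.List.Base using (List; allFin; cartesianProduct; filter; length; map)
open import Data.Nat.Base using (ℕ; zero; suc; _+_; _*_; _≤_; z≤n; s≤s)
open import Data.Nat.Properties using (suc-injective; 1+n≢n)
import Data.Nat.Properties as ℕ
open import Data.Nat.ListAction using (sum)
open import Data.Product using (∃; ∃!; _×_; _,_; proj₁)
open import Data.Sum.Base using (_⊎_; inj₁; inj₂; swap)
open import Function.Bundles using (_⇔_; _↣_; Injection)
open import Level using (0ℓ)
open import Relation.Binary.Construct.Closure.ReflexiveTransitive using (Star; ε; _◅_)
open import Relation.Binary.Core using (Rel)
open import Relation.Binary.Definitions using (Decidable; Symmetric)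
open import Relation.Binary.PropositionalEquality using (_≡_; _≢_; refl; sym; trans; cong)
open import Relation.Nullary using (¬_; yes; no; _×-dec_; _⊎-dec_; contradiction)
open import Relation.Nullary.Decidable using (map′)
open import Relation.Unary using () renaming (Decidable to Decidable₁)

record Graph (n : ℕ) : Set₁ where
  field
    Adj    : Rel (Fin n) 0ℓ
    adj?   : Decidable Adj
    symm   : Symmetric Adj
    irrefl : ∀ {v} → ¬ Adj v v

open Graph public

Walk : ∀ {n} → Graph n → Rel (Fin n) 0ℓ
Walk G = Star (Adj G)

walkLength : ∀ {n} {R : Rel (Fin n) 0ℓ} {u v} → Star R u v → ℕ
walkLength ε       = 0
walkLength (_ ◅ p) = suc (walkLength p)

Connected : ∀ {n} → Graph n → Set
Connected G = ∀ u v → Walk G u v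

Bipartite : ∀ {n} → Graph n → Set
Bipartite {n} G = ∃ λ (colour : Fin n → Bool) → ∀ {u v} → Adj G u v → colour u ≢ colour v

WalkOfLength : ∀ {n} → Graph n → Fin n → Fin n → ℕ → Set
WalkOfLength G u v k = ∃ λ (p : Walk G u v) → walkLength p ≡ k

IsDistance : ∀ {n} → Graph n → Fin n → Fin n → ℕ → Set
IsDistance G u v k = WalkOfLength G u v k × (∀ (p : Walk G u v) → k ≤ walkLength p)

walkOfLength? : ∀ {n} (G : Graph n) (u v : Fin n) → Decidable₁ (WalkOfLength G u v)
walkOfLength? G u v zero = map′ (λ { refl → ε , refl }) (λ { (ε , _) → refl }) (u ≟ v)
walkOfLength? G u v (suc k) =
  map′ (λ { (_ , e , p , eq) → e ◅ p , cong suc eq })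
       (λ { (e ◅ p , eq) → _ , e , p , suc-injective eq })
       (any? λ w → adj? G u w ×-dec walkOfLength? G w v k)

least : {P : ℕ → Set} → Decidable₁ P → ∀ k → P k → ∃ λ l → P l × (∀ j → P j → l ≤ j)
least P? zero    p = zero , p , λ _ _ → z≤n
least P? (suc k) p with P? zero
... | yes p₀ = zero , p₀ , λ _ _ → z≤n
... | no ¬p₀ with least (λ j → P? (suc j)) k p
...   | l , pl , l-least = suc l , pl , λ
  { zero    p₀ → contradiction p₀ ¬p₀
  ; (suc j) pj → s≤s (l-least j pj)
  }

shortest : ∀ {n} (G : Graph n) → Connected G → ∀ u v → ∃ (IsDistance G u v)
shortest G conn u v with least (walkOfLength? G u v) _ (conn u v , refl)
... | k , w , k-least = k , w , λ p → k-least _ (p , refl)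

-- The proof of connectedness only bounds the search; the value does not depend on it.
distance : ∀ {n} (G : Graph n) → Connected G → Fin n → Fin n → ℕ
distance G conn u v = proj₁ (shortest G conn u v)

-- An unordered pair {u , v} of distinct vertices is listed once, with u < v.
pairs : ∀ n → List (Fin n × Fin n)
pairs n = filter (λ (u , v) → u <? v) (cartesianProduct (allFin n) (allFin n))

edges : ∀ {n} → Graph n → List (Fin n × Fin n)
edges {n} G = filter (λ (u , v) → adj? G u v) (pairs n)

size : ∀ {n} → Graph n → ℕ
size G = length (edges G)

wiener : ∀ {n} (G : Graph n) → Connected G → ℕ
wiener {n} G conn = sum (map (λ (u , v) → distance G conn u v) (pairs n))

-- closer G conn u v is n_u(e) for the edge e = uv, and closer G conn v u is n_v(e).
closer : ∀ {n} (G : Graph n) → Connected G → Fin n → Fin n → ℕ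
closer {n} G conn u v =
  length (filter (λ w → distance G conn u w ℕ.<? distance G conn v w) (allFin n))

szeged : ∀ {n} (G : Graph n) → Connected G → ℕ
szeged G conn = sum (map (λ (u , v) → closer G conn u v * closer G conn v u) (edges G))

Next : ∀ {k} → Rel (Fin k) 0ℓ
Next {k} i j = toℕ j ≡ suc (toℕ i) ⊎ (suc (toℕ i) ≡ k × toℕ j ≡ 0)

next? : ∀ {k} → Decidable (Next {k})
next? {k} i j = (toℕ j ℕ.≟ suc (toℕ i)) ⊎-dec ((suc (toℕ i) ℕ.≟ k) ×-dec (toℕ j ℕ.≟ 0))

-- The cycle on 3 + ℓ vertices, so that every cycle has length at least 3.
cycle : ∀ ℓ → Graph (3 + ℓ)
cycle ℓ = record
  { Adj    = λ i j → Next i j ⊎ Next j i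
  ; adj?   = λ i j → next? i j ⊎-dec next? j i
  ; symm   = swap
  ; irrefl = λ { (inj₁ e) → next-irrefl e ; (inj₂ e) → next-irrefl e }
  }
  where
  next-irrefl : {i : Fin (3 + ℓ)} → ¬ Next i i
  next-irrefl (inj₁ eq) = 1+n≢n (sym eq)
  next-irrefl (inj₂ (eq , eq₀)) with () ← trans (sym eq) (cong suc eq₀)

C₄ : Graph 4
C₄ = cycle 1

-- A cycle in G is a (not necessarily induced) copy of some cycle graph.
record CycleIn {n} (G : Graph n) : Set where
  field
    ℓ         : ℕ
    vertices  : Fin (3 + ℓ) ↣ Fin n
    adjacent  : ∀ {i j} → Adj (cycle ℓ) i j → Adj G (Injection.to vertices i) (Injection.to vertices j)

IsTree : ∀ {n} → Graph n → Set
IsTree G = Connected G × ¬ CycleIn G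

-- The vertices and the edges of the copy of a graph H inside Fin n
-- given by an injection of the vertices of H.

VertexOf : ∀ {a n} → Fin a ↣ Fin n → Fin n → Set
VertexOf f v = ∃ λ i → Injection.to f i ≡ v

EdgeOf : ∀ {a n} → Graph a → Fin a ↣ Fin n → Rel (Fin n) 0ℓ
EdgeOf H f u v = ∃ λ i → ∃ λ j → Adj H i j × Injection.to f i ≡ u × Injection.to f j ≡ v

record UnionSharingVertex {n a b} (G : Graph n) (H : Graph a) (K : Graph b) : Set where
  field
    f              : Fin a ↣ Fin n
    g              : Fin b ↣ Fin n
    vertex-union   : ∀ v → VertexOf f v ⊎ VertexOf g v
    edge-union     : ∀ u v → Adj G u v ⇔ (EdgeOf H f u v ⊎ EdgeOf K g u v)
    shared-vertex  : ∃! _≡_ λ v → VertexOf f v × VertexOf g v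
    no-shared-edge : ∀ u v → ¬ (EdgeOf H f u v × EdgeOf K g u v)

{-# OPTIONS --safe #-}
module Submission where

-- Orient every edge ab that separates x from y so that a is the end nearer to x, and let μ x y be the
-- number of these edges. In a bipartite graph no vertex is equidistant from the ends of an edge, so
-- 2 Sz sums μ x y over all ordered pairs, while 2 W sums d x y. A geodesic consists of separating
-- edges, hence excess x y = μ x y − d x y ≥ 0, and the claim is that the total excess is at least 8 n − 16.
--
-- If G has no 4-cycle, fix x. Since m ≥ n, some y has two neighbours u₁, u₂ closer to x; with neighbours
-- w₁, w₂ of these, closer still, the excesses of x with y, u₁, u₂, w₁, w₂ are at least 2, 2, 2, 1, 1.
-- So the total is at least 8 n.
--
-- If G has a 4-cycle, every vertex x has excess at least 4 in total with the vertices of the cycle, with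
-- equality only if x reaches the cycle through a gate, that is, its distances to the cycle are k, k + 1,
-- k + 2, k + 1. Counting pairs inside the cycle once and crossing pairs twice gives 16 + 8 (n − 4).
-- Equality forces every outside vertex to have a gate and no excess with any other outside vertex;
-- then all gates coincide, and since two closer neighbours of a vertex cost excess, what hangs at
-- the gate is a tree.

open import Defs
open import Data.Nat.Base as ℕ using (ℕ; _∸_)
open import Data.Product.Base using (∃; _×_)
open import Function.Bundles using (_⇔_)
open import Relation.Binary.PropositionalEquality using (_≡_)

open import Data.Bool.Base using (Bool; if_then_else_; not)
open import Data.Bool.Properties using (¬-not)
open import Data.Fin.Base using (Fin; zero; suc; toℕ; fromℕ; fromℕ<; inject₁; punchIn; punchOut)
import Data.Fin.Properties as Fin
import Data.Integer.Base as ℤ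
import Data.Integer.Properties as ℤ
import Data.Integer.Tactic.RingSolver as ℤ-Solver
open import Data.List.Base
  using (List; []; _∷_; _++_; allFin; applyUpTo; cartesianProduct; filter; length; lookup; map; tabulate)
open import Data.List.Membership.Propositional using (_∈_; _∉_)
open import Data.List.Membership.Propositional.Properties
  using (∈-allFin; ∈-applyUpTo⁻; ∈-cartesianProduct⁺; ∈-filter⁺; ∈-filter⁻; ∈-lookup; ∈-∃++; ∈-++⁻; ∈-++⁺ˡ; ∈-++⁺ʳ)
open import Data.List.Properties using (length-++; length-applyUpTo; map-++; map-∘)
open import Data.List.Relation.Binary.Disjoint.Propositional using (Disjoint)
open import Data.List.Relation.Unary.All as All using (All; []; _∷_)
import Data.List.Relation.Unary.All.Properties as All
open import Data.List.Relation.Unary.AllPairs as AllPairs using ([]; _∷_)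
open import Data.List.Relation.Unary.Any using (here; there)
open import Data.List.Relation.Unary.Unique.Propositional using (Unique)
import Data.List.Relation.Unary.Unique.Propositional.Properties as Unique
open import Data.Nat.Base using (zero; suc; pred; _+_; _≤_; _<_; z≤n; s≤s)
import Data.Nat.ListAction as List
open import Data.Nat.ListAction.Properties using (sum-++)
open import Data.Nat.Properties as ℕ using (+-0-commutativeMonoid; +-*-semiring; module ≤-Reasoning)
open import Data.Nat.Tactic.RingSolver using (solve-∀)
open import Algebra.Properties.CommutativeMonoid.Sum +-0-commutativeMonoid
  using (sum; sum-syntax; sum-cong-≗; sum-remove; ∑-distrib-+; ∑-comm)
open import Algebra.Properties.Semiring.Sum +-*-semiring using (*-distribˡ-sum; *-distribʳ-sum)
open import Data.Product.Base using (_,_; proj₁; proj₂)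
open import Data.Product.Properties using (≡-dec)
open import Data.Sum.Base using (_⊎_; inj₁; inj₂; [_,_]′; swap)
open import Function.Base using (_∘_; id; _$_)
open import Function.Bundles using (_↣_; mk↣; mk⇔; module Injection; module Equivalence)
open import Relation.Binary.Construct.Closure.ReflexiveTransitive as Star using (ε; _◅_; _◅◅_)
open import Relation.Binary.Definitions using (tri<; tri≈; tri>)
open import Relation.Binary.PropositionalEquality
  using (_≢_; refl; sym; trans; cong; cong₂; subst; subst₂; module ≡-Reasoning)
open import Relation.Nullary using (¬_; Dec; yes; no; does; contradiction; ¬?; _×-dec_; _⊎-dec_; _→-dec_)
open import Relation.Nullary.Decidable as Dec using (from-yes; map′)
open import Relation.Unary using (Decidable)

-- Counting and summation

-- The product of `closer` terms of an edge uv counts the ordered pairs (x, y) with x on the side of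
-- u and y on the side of v; exchanging sums collects for each pair the edges between them. The two
-- cases need different accounting. Without 4-cycles every single row of the excess matrix sums to
-- at least 8. In the extremal graph, however, a vertex of the tree has row sum 4 only, and the
-- surplus sits in the rows of the other three cycle vertices; hence rows are charged to the cycle
-- there and crossing pairs are counted from both ends. Both directions of the equality case pass
-- through `Tailed`: a 4-cycle with three vertices of degree two, such that parents are unique in
-- the rest, seen from any root in it. This is the form in which a tree is visible to distances.
-- Reaching it uses that zero excess leaves one separating edge per level. Leaving it needs upper
-- bounds on excess, and these come from subadditivity of `μ`, which rests on bipartiteness.

⟦_⟧ : {P : Set} → Dec P → ℕ
⟦ p? ⟧ = if does p? then 1 else 0

⟦⟧-yes : {P : Set} (p? : Dec P) → P → ⟦ p? ⟧ ≡ 1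
⟦⟧-yes (yes _) _ = refl
⟦⟧-yes (no ¬p) p = contradiction p ¬p

⟦⟧-no : {P : Set} (p? : Dec P) → ¬ P → ⟦ p? ⟧ ≡ 0
⟦⟧-no (yes p) ¬p = contradiction p ¬p
⟦⟧-no (no _)  _  = refl

⟦⟧-cong : {P Q : Set} (p? : Dec P) (q? : Dec Q) → (P → Q) → (Q → P) → ⟦ p? ⟧ ≡ ⟦ q? ⟧
⟦⟧-cong p? (yes q) _ g = ⟦⟧-yes p? (g q)
⟦⟧-cong p? (no ¬q) f _ = ⟦⟧-no p? (¬q ∘ f)

⟦⟧-× : {P Q : Set} (p? : Dec P) (q? : Dec Q) → ⟦ p? ⟧ ℕ.* ⟦ q? ⟧ ≡ ⟦ p? ×-dec q? ⟧
⟦⟧-× (yes _) (yes _) = refl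
⟦⟧-× (yes _) (no _)  = refl
⟦⟧-× (no _)  _       = refl

module _ {A : Set} where

  sum-map-filter : {P : A → Set} (P? : Decidable P) (f : A → ℕ) (xs : List A) →
    List.sum (map f (filter P? xs)) ≡ List.sum (map (λ x → ⟦ P? x ⟧ ℕ.* f x) xs)
  sum-map-filter P? f []       = refl
  sum-map-filter P? f (x ∷ xs) with P? x
  ... | yes _ = cong₂ _+_ (sym (ℕ.+-identityʳ (f x))) (sum-map-filter P? f xs)
  ... | no  _ = sum-map-filter P? f xs

  length-as-sum : (xs : List A) → length xs ≡ List.sum (map (λ _ → 1) xs)
  length-as-sum []       = refl
  length-as-sum (_ ∷ xs) = cong suc (length-as-sum xs)

  sum-map-cartesianProduct : {B : Set} (f : A × B → ℕ) (xs : List A) (ys : List B) →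
    List.sum (map f (cartesianProduct xs ys)) ≡
    List.sum (map (λ x → List.sum (map (λ y → f (x , y)) ys)) xs)
  sum-map-cartesianProduct f []       ys = refl
  sum-map-cartesianProduct f (x ∷ xs) ys = begin
    List.sum (map f (map (x ,_) ys ++ cartesianProduct xs ys))
      ≡⟨ cong List.sum (map-++ f (map (x ,_) ys) _) ⟩
    List.sum (map f (map (x ,_) ys) ++ map f (cartesianProduct xs ys))
      ≡⟨ sum-++ (map f (map (x ,_) ys)) _ ⟩
    List.sum (map f (map (x ,_) ys)) + List.sum (map f (cartesianProduct xs ys))
      ≡⟨ cong₂ _+_ (cong List.sum (sym (map-∘ ys))) (sum-map-cartesianProduct f xs ys) ⟩
    _ ∎
    where open ≡-Reasoning

  -- Once the occurrence of `x` is cut out of the larger list, the remaining entries of `xs`, all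
  -- different from `x`, still lie in what is left.
  sum-map-mono-⊆ : (f : A → ℕ) {xs ys : List A} → Unique xs → (∀ {x} → x ∈ xs → x ∈ ys) →
    List.sum (map f xs) ≤ List.sum (map f ys)
  sum-map-mono-⊆ f {[]}     _            _     = z≤n
  sum-map-mono-⊆ f {x ∷ xs} (x∉xs ∷ uxs) xs⊆ys with ∈-∃++ (xs⊆ys (here refl))
  ... | ys , zs , refl = begin
    f x + List.sum (map f xs)
      ≤⟨ ℕ.+-monoʳ-≤ (f x) (sum-map-mono-⊆ f uxs xs⊆) ⟩
    f x + List.sum (map f (ys ++ zs))
      ≡⟨ cong (f x +_) (split ys zs) ⟩
    f x + (List.sum (map f ys) + List.sum (map f zs))
      ≡⟨ rearrange (f x) (List.sum (map f ys)) _ ⟩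
    List.sum (map f ys) + (f x + List.sum (map f zs))
      ≡⟨ split ys (x ∷ zs) ⟨
    List.sum (map f (ys ++ x ∷ zs)) ∎
    where
    open ≤-Reasoning
    split : ∀ us vs → List.sum (map f (us ++ vs)) ≡ List.sum (map f us) + List.sum (map f vs)
    split us vs = trans (cong List.sum (map-++ f us vs)) (sum-++ (map f us) (map f vs))
    rearrange : ∀ a b c → a + (b + c) ≡ b + (a + c)
    rearrange = solve-∀
    xs⊆ : ∀ {w} → w ∈ xs → w ∈ ys ++ zs
    xs⊆ w∈xs with ∈-++⁻ ys (xs⊆ys (there w∈xs))
    ... | inj₁ w∈ys         = ∈-++⁺ˡ w∈ys
    ... | inj₂ (here refl)  = contradiction refl (All.lookup x∉xs w∈xs)
    ... | inj₂ (there w∈zs) = ∈-++⁺ʳ ys w∈zs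

  length-mono-⊆ : {xs ys : List A} → Unique xs → (∀ {x} → x ∈ xs → x ∈ ys) → length xs ≤ length ys
  length-mono-⊆ {xs} {ys} u xs⊆ys =
    subst₂ _≤_ (sym (length-as-sum xs)) (sym (length-as-sum ys)) (sum-map-mono-⊆ (λ _ → 1) u xs⊆ys)

  length-filter-⊎ : {P Q R : A → Set} (P? : Decidable P) (Q? : Decidable Q) (R? : Decidable R) →
    (∀ {x} → P x → Q x ⊎ R x) → ∀ xs →
    length (filter P? xs) ≤ length (filter Q? xs) + length (filter R? xs)
  length-filter-⊎ P? Q? R? split [] = z≤n
  length-filter-⊎ P? Q? R? split (x ∷ xs) with P? x | Q? x | R? x | length-filter-⊎ P? Q? R? split xs
  ... | yes p | no ¬q | no ¬r | _  = contradiction (split p) [ ¬q , ¬r ]′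
  ... | yes _ | yes _ | no _  | ih = s≤s ih
  ... | yes _ | yes _ | yes _ | ih = s≤s (ℕ.≤-trans ih (ℕ.+-monoʳ-≤ _ (ℕ.n≤1+n _)))
  ... | yes _ | no _  | yes _ | ih = ℕ.≤-trans (s≤s ih) (ℕ.≤-reflexive (sym (ℕ.+-suc _ _)))
  ... | no _  | yes _ | yes _ | ih = ℕ.≤-trans ih (ℕ.+-mono-≤ (ℕ.n≤1+n _) (ℕ.n≤1+n _))
  ... | no _  | yes _ | no _  | ih = ℕ.m≤n⇒m≤1+n ih
  ... | no _  | no _  | yes _ | ih = ℕ.≤-trans ih (ℕ.+-monoʳ-≤ _ (ℕ.n≤1+n _))
  ... | no _  | no _  | no _  | ih = ih

sum-map-tabulate : ∀ {A : Set} {n} (f : A → ℕ) (g : Fin n → A) →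
  List.sum (map f (tabulate g)) ≡ sum (f ∘ g)
sum-map-tabulate {n = zero}  f g = refl
sum-map-tabulate {n = suc n} f g = cong (f (g zero) +_) (sum-map-tabulate f (g ∘ suc))

sum-map-filter-pairs : ∀ {n} {P : Fin n × Fin n → Set} (P? : Decidable P) (f : Fin n × Fin n → ℕ) →
  List.sum (map f (filter P? (cartesianProduct (allFin n) (allFin n)))) ≡
  ∑[ u < n ] ∑[ v < n ] (⟦ P? (u , v) ⟧ ℕ.* f (u , v))
sum-map-filter-pairs {n} P? f = begin
  _ ≡⟨ sum-map-filter P? f (cartesianProduct (allFin n) (allFin n)) ⟩
  _ ≡⟨ sum-map-cartesianProduct _ (allFin n) (allFin n) ⟩
  _ ≡⟨ sum-map-tabulate {n = n} _ id ⟩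
  _ ≡⟨ sum-cong-≗ {n} (λ u → sum-map-tabulate {n = n} _ id) ⟩
  _ ∎
  where open ≡-Reasoning

length-filter-allFin : ∀ {n} {P : Fin n → Set} (P? : Decidable P) →
  length (filter P? (allFin n)) ≡ ∑[ v < n ] ⟦ P? v ⟧
length-filter-allFin {n} P? = begin
  _ ≡⟨ length-as-sum (filter P? (allFin n)) ⟩
  _ ≡⟨ sum-map-filter P? _ (allFin n) ⟩
  _ ≡⟨ sum-map-tabulate {n = n} _ id ⟩
  _ ≡⟨ sum-cong-≗ {n} (λ v → ℕ.*-identityʳ ⟦ P? v ⟧) ⟩
  _ ∎
  where open ≡-Reasoning

sum-mono : ∀ {n} {f g : Fin n → ℕ} → (∀ i → f i ≤ g i) → sum f ≤ sum g
sum-mono {zero}  _   = z≤n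
sum-mono {suc n} f≤g = ℕ.+-mono-≤ (f≤g zero) (sum-mono (f≤g ∘ suc))

-- Slack in a single term would show in the total. This is how equality of totals is pushed down to
-- single vertices and pairs.
sum-tight : ∀ {n} {f g : Fin n → ℕ} → (∀ i → f i ≤ g i) → sum g ≤ sum f → ∀ i → g i ≤ f i
sum-tight {suc n} {f} {g} f≤g Σg≤Σf zero = ℕ.+-cancelʳ-≤ _ _ _ $ begin
  g zero + sum (f ∘ suc) ≤⟨ ℕ.+-monoʳ-≤ (g zero) (sum-mono (f≤g ∘ suc)) ⟩
  g zero + sum (g ∘ suc) ≤⟨ Σg≤Σf ⟩
  f zero + sum (f ∘ suc) ∎
  where open ≤-Reasoning
sum-tight {suc n} {f} {g} f≤g Σg≤Σf (suc i) = sum-tight (f≤g ∘ suc) (ℕ.+-cancelˡ-≤ _ _ _ $ begin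
  f zero + sum (g ∘ suc) ≤⟨ ℕ.+-monoˡ-≤ _ (f≤g zero) ⟩
  g zero + sum (g ∘ suc) ≤⟨ Σg≤Σf ⟩
  f zero + sum (f ∘ suc) ∎) i
  where open ≤-Reasoning

sum-const : ∀ n c → ∑[ _ < n ] c ≡ n ℕ.* c
sum-const zero    c = refl
sum-const (suc n) c = cong (c +_) (sum-const n c)

sum-over-unique : ∀ {n} (f : Fin n → ℕ) {xs : List (Fin n)} → Unique xs → List.sum (map f xs) ≤ sum f
sum-over-unique {n} f u =
  ℕ.≤-trans (sum-map-mono-⊆ f u (λ {x} _ → ∈-allFin x)) (ℕ.≤-reflexive (sum-map-tabulate f id))

double-sum-pairs : ∀ {n} (f : Fin n → Fin n → ℕ) → (∀ u v → f u v ≡ f v u) → (∀ u → f u u ≡ 0) →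
  2 ℕ.* ∑[ u < n ] ∑[ v < n ] (⟦ u Fin.<? v ⟧ ℕ.* f u v) ≡ ∑[ u < n ] ∑[ v < n ] f u v
double-sum-pairs {n} f f-sym f-diag = begin
  2 ℕ.* S
    ≡⟨ cong (S +_) (ℕ.+-identityʳ S) ⟩
  S + S
    ≡⟨ cong (S +_) (∑-comm (λ u v → ⟦ u Fin.<? v ⟧ ℕ.* f u v)) ⟩
  S + ∑[ u < n ] ∑[ v < n ] (⟦ v Fin.<? u ⟧ ℕ.* f v u)
    ≡⟨ ∑-distrib-+ (λ u → ∑[ v < n ] (⟦ u Fin.<? v ⟧ ℕ.* f u v)) _ ⟨
  ∑[ u < n ] (∑[ v < n ] (⟦ u Fin.<? v ⟧ ℕ.* f u v) + ∑[ v < n ] (⟦ v Fin.<? u ⟧ ℕ.* f v u))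
    ≡⟨ sum-cong-≗ {n} (λ u → trans (sym (∑-distrib-+ (λ v → ⟦ u Fin.<? v ⟧ ℕ.* f u v) _))
                                   (sum-cong-≗ {n} (pointwise u))) ⟩
  ∑[ u < n ] ∑[ v < n ] f u v ∎
  where
  open ≡-Reasoning
  S = ∑[ u < n ] ∑[ v < n ] (⟦ u Fin.<? v ⟧ ℕ.* f u v)
  pointwise : ∀ u v → ⟦ u Fin.<? v ⟧ ℕ.* f u v + ⟦ v Fin.<? u ⟧ ℕ.* f v u ≡ f u v
  pointwise u v with Fin.<-cmp u v
  ... | tri< u<v _ v≮u = begin
    _ ≡⟨ cong₂ (λ i j → i ℕ.* f u v + j ℕ.* f v u) (⟦⟧-yes (u Fin.<? v) u<v) (⟦⟧-no (v Fin.<? u) v≮u) ⟩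
    1 ℕ.* f u v + 0 ≡⟨ trans (ℕ.+-identityʳ _) (ℕ.*-identityˡ _) ⟩
    f u v ∎
  ... | tri≈ u≮u refl _ = trans (cong (λ i → i ℕ.* f u u + i ℕ.* f u u) (⟦⟧-no (u Fin.<? u) u≮u)) (sym (f-diag u))
  ... | tri> u≮v _ v<u = begin
    _ ≡⟨ cong₂ (λ i j → i ℕ.* f u v + j ℕ.* f v u) (⟦⟧-no (u Fin.<? v) u≮v) (⟦⟧-yes (v Fin.<? u) v<u) ⟩
    1 ℕ.* f v u ≡⟨ trans (ℕ.*-identityˡ _) (f-sym v u) ⟩
    f u v ∎

-- Used for two lists: the four vertices of a 4-cycle, where `split` breaks up the sums, and three
-- of them, where `Fin r` becomes the vertex set of the tree.
record Complement {n} (xs : List (Fin n)) : Set where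
  field
    r     : ℕ
    n≡    : n ≡ length xs + r
    ρ     : Fin r → Fin n
    inj   : ∀ {i j} → ρ i ≡ ρ j → i ≡ j
    avoid : ∀ i → ρ i ∉ xs
    cover : ∀ {v} → v ∉ xs → ∃ λ i → ρ i ≡ v
    split : ∀ f → sum f ≡ List.sum (map f xs) + sum (f ∘ ρ)

complement : ∀ {n} {xs : List (Fin n)} → Unique xs → Complement xs
complement {xs = []} _ = record
  { n≡ = refl ; ρ = id ; inj = id ; avoid = λ _ () ; cover = λ {v} _ → v , refl ; split = λ _ → refl }
complement {xs = x ∷ xs} (x∉xs ∷ uxs) with complement uxs
-- `x` lies off `xs`, so the complement of `xs` cannot be empty.
... | record { r = zero ; cover = cover }
  with () ← proj₁ (cover (λ x∈xs → contradiction refl (All.lookup x∉xs x∈xs)))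
... | record { r = suc r ; n≡ = n≡ ; ρ = ρ ; inj = inj ; avoid = avoid ; cover = cover ; split = split }
  with cover (λ x∈xs → contradiction refl (All.lookup x∉xs x∈xs))
... | i₀ , refl = record
  { n≡    = trans n≡ (ℕ.+-suc _ _)
  ; ρ     = ρ ∘ punchIn i₀
  ; inj   = Fin.punchIn-injective i₀ _ _ ∘ inj
  ; avoid = λ { i (here eq)  → Fin.punchInᵢ≢i i₀ i (inj eq)
              ; i (there p)  → avoid _ p }
  ; cover = cover-rest
  ; split = λ f → begin
      sum f
        ≡⟨ split f ⟩
      List.sum (map f xs) + sum (f ∘ ρ)
        ≡⟨ cong (List.sum (map f xs) +_) (sum-remove {i = i₀} (f ∘ ρ)) ⟩
      List.sum (map f xs) + (f (ρ i₀) + sum (f ∘ ρ ∘ punchIn i₀))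
        ≡⟨ rearrange (List.sum (map f xs)) (f (ρ i₀)) _ ⟩
      f (ρ i₀) + List.sum (map f xs) + sum (f ∘ ρ ∘ punchIn i₀) ∎
  }
  where
  open ≡-Reasoning
  rearrange : ∀ a b c → a + (b + c) ≡ b + a + c
  rearrange = solve-∀
  cover-rest : ∀ {v} → v ∉ ρ i₀ ∷ xs → ∃ λ i → ρ (punchIn i₀ i) ≡ v
  cover-rest v∉ with cover (v∉ ∘ there)
  ... | i , refl = punchOut i₀≢i , cong ρ (Fin.punchIn-punchOut i₀≢i)
    where i₀≢i = λ i₀≡i → v∉ (here (cong ρ (sym i₀≡i)))

-- Cycles

-- A shortest closed stretch of a walk without backtracking is a cycle.
closed-walk⇒cycle : ∀ {b} (H : Graph b) (f : ℕ → Fin b) K →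
  (∀ m → m < K → Adj H (f m) (f (suc m))) → (∀ m → 2 + m ≤ K → f m ≢ f (2 + m)) →
  ∀ {i j} → i < j → j ≤ K → f i ≡ f j → CycleIn H
closed-walk⇒cycle {b} H f K step no-return i<j j≤K fi≡fj = from-least (least period? _ (period i<j j≤K fi≡fj))
  where
  Period : ℕ → Set
  Period g = ∃ λ (i : Fin (suc K)) → toℕ i + suc g ≤ K × f (toℕ i) ≡ f (toℕ i + suc g)

  period? : Decidable Period
  period? g = Fin.any? λ i → (toℕ i + suc g ℕ.≤? K) ×-dec (f (toℕ i) Fin.≟ f (toℕ i + suc g))

  period : ∀ {i j} → i < j → j ≤ K → f i ≡ f j → Period (j ∸ suc i)
  period {i} {j} i<j j≤K eq = fromℕ< (s≤s i≤K) ,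
    subst (_≤ K) (sym i+) j≤K , trans (cong f toℕ-i) (trans eq (cong f (sym i+)))
    where
    i≤K = ℕ.≤-trans (ℕ.<⇒≤ i<j) j≤K
    toℕ-i = Fin.toℕ-fromℕ< (s≤s i≤K)
    i+ : toℕ (fromℕ< (s≤s i≤K)) + suc (j ∸ suc i) ≡ j
    i+ = trans (cong (_+ suc (j ∸ suc i)) toℕ-i) (trans (ℕ.+-suc i _) (ℕ.m+[n∸m]≡n i<j))

  from-least : (∃ λ g → Period g × (∀ h → Period h → g ≤ h)) → CycleIn H
  -- `g` is one less than the length of the closed stretch. Length 1 would be a loop and length 2 a
  -- step back; from length 3 on, a repeated vertex would give a shorter stretch.
  from-least (zero , (i , le , eq) , _) =
    contradiction (subst (Adj H _) (sym (trans eq (cong f (ℕ.+-comm (toℕ i) 1))))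
      (step (toℕ i) (subst (_≤ K) (ℕ.+-comm (toℕ i) 1) le))) (irrefl H)
  from-least (suc zero , (i , le , eq) , _) =
    contradiction (trans eq (cong f (ℕ.+-comm (toℕ i) 2))) (no-return (toℕ i) (subst (_≤ K) (ℕ.+-comm (toℕ i) 2) le))
  from-least (suc (suc ℓ) , (i , le , eq) , minimal) = record
    { ℓ = ℓ
    ; vertices = mk↣ {to = v} injective
    ; adjacent = [ next-adj , symm H ∘ next-adj ]′
    }
    where
    v : Fin (3 + ℓ) → Fin b
    v t = f (toℕ i + toℕ t)
    no-repeat : ∀ {s t : Fin (3 + ℓ)} → toℕ s < toℕ t → v s ≢ v t
    no-repeat {s} {t} s<t vs≡vt = contradiction
      (minimal _ (period (ℕ.+-monoʳ-< (toℕ i) s<t) (ℕ.≤-trans (ℕ.+-monoʳ-≤ (toℕ i) (ℕ.<⇒≤ (Fin.toℕ<n t))) le) vs≡vt))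
      (ℕ.<⇒≱ (ℕ.s≤s⁻¹ (begin-strict
        suc (toℕ i + toℕ t ∸ suc (toℕ i + toℕ s))
          ≡⟨ cong (λ k → suc (toℕ i + toℕ t ∸ k)) (ℕ.+-suc (toℕ i) (toℕ s)) ⟨
        suc (toℕ i + toℕ t ∸ (toℕ i + suc (toℕ s)))
          ≡⟨ cong suc (ℕ.[m+n]∸[m+o]≡n∸o (toℕ i) (toℕ t) (suc (toℕ s))) ⟩
        suc (toℕ t ∸ suc (toℕ s))
          ≤⟨ ℕ.∸-monoʳ-< {toℕ t} {suc (toℕ s)} {toℕ s} (ℕ.n<1+n _) s<t ⟩
        toℕ t ∸ toℕ s
          ≤⟨ ℕ.m∸n≤m (toℕ t) (toℕ s) ⟩
        toℕ t
          <⟨ Fin.toℕ<n t ⟩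
        3 + ℓ ∎)))
      where open ≤-Reasoning
    injective : ∀ {s t} → v s ≡ v t → s ≡ t
    injective {s} {t} vs≡vt with Fin.<-cmp s t
    ... | tri< s<t _ _ = contradiction vs≡vt (no-repeat s<t)
    ... | tri≈ _ s≡t _ = s≡t
    ... | tri> _ _ t<s = contradiction (sym vs≡vt) (no-repeat t<s)
    step-adj : ∀ (s : Fin (3 + ℓ)) → Adj H (v s) (f (toℕ i + suc (toℕ s)))
    step-adj s = subst (λ k → Adj H (v s) (f k)) (sym (ℕ.+-suc (toℕ i) (toℕ s)))
      (step _ (ℕ.<-≤-trans (ℕ.+-monoʳ-< (toℕ i) (Fin.toℕ<n s)) le))
    next-adj : ∀ {s t} → Next s t → Adj H (v s) (v t)
    next-adj {s} {t} (inj₁ t≡1+s) = subst (λ k → Adj H (v s) (f (toℕ i + k))) (sym t≡1+s) (step-adj s)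
    next-adj {s} {t} (inj₂ (1+s≡ , t≡0)) = subst (Adj H (v s))
      (trans (cong (λ k → f (toℕ i + k)) 1+s≡) (trans (sym eq)
        (cong f (sym (trans (cong (toℕ i +_) t≡0) (ℕ.+-identityʳ _))))))
      (step-adj s)

-- The sequence P (k - 1), …, P 0, R 0, R 1, ….
prepend : {A : Set} → ℕ → (ℕ → A) → (ℕ → A) → ℕ → A
prepend zero    P R m       = R m
prepend (suc k) P R zero    = P k
prepend (suc k) P R (suc m) = prepend k P R m

prepend-all : {A : Set} {P R : ℕ → A} {S : A → Set} → (∀ i → S (P i)) → (∀ m → S (R m)) → ∀ k m → S (prepend k P R m)
prepend-all         sP sR zero    m       = sR m
prepend-all         sP sR (suc k) zero    = sP k
prepend-all {S = S} sP sR (suc k) (suc m) = prepend-all {S = S} sP sR k m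

prepend-+ : {A : Set} {P R : ℕ → A} → ∀ k m → prepend k P R (k + m) ≡ R m
prepend-+ zero    m = refl
prepend-+ (suc k) m = prepend-+ k m

module _ {A : Set} {Q : A → A → Set} {P R : ℕ → A} where

  prepend-step : ∀ k K → (∀ i → suc i < k → Q (P (suc i)) (P i)) → Q (P 0) (R 0) →
    (∀ m → m < K → Q (R m) (R (suc m))) →
    ∀ m → m < k + K → Q (prepend k P R m) (prepend k P R (suc m))
  prepend-step zero          K p pr r m       m<   = r m m<
  prepend-step (suc zero)    K p pr r zero    _    = pr
  prepend-step (suc zero)    K p pr r (suc m) m<   = r m (ℕ.s≤s⁻¹ m<)
  prepend-step (suc (suc k)) K p pr r zero    _    = p k ℕ.≤-refl
  prepend-step (suc (suc k)) K p pr r (suc m) m<   =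
    prepend-step (suc k) K (λ i i< → p i (ℕ.m<n⇒m<1+n i<)) pr r m (ℕ.s≤s⁻¹ m<)

  -- Besides the pairs inside `P` and inside `R`, two pairs at distance two straddle the seam: `P 1`
  -- with `R 0`, present only if `1 < k`, and `P 0` with `R 1`.
  prepend-step₂ : ∀ k K → (∀ i → 2 + i < k → Q (P (2 + i)) (P i)) → (1 < k → Q (P 1) (R 0)) → Q (P 0) (R 1) →
    (∀ m → 2 + m ≤ K → Q (R m) (R (2 + m))) →
    ∀ m → 2 + m ≤ k + K → Q (prepend k P R m) (prepend k P R (2 + m))
  prepend-step₂ zero                K p p₁ p₀ r m       m< = r m m<
  prepend-step₂ (suc zero)          K p p₁ p₀ r zero    _  = p₀
  prepend-step₂ (suc zero)          K p p₁ p₀ r (suc m) m< = r m (ℕ.s≤s⁻¹ m<)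
  prepend-step₂ (suc (suc zero))    K p p₁ p₀ r zero    _  = p₁ (s≤s (s≤s z≤n))
  prepend-step₂ (suc (suc (suc k))) K p p₁ p₀ r zero    _  = p k ℕ.≤-refl
  prepend-step₂ (suc (suc k))       K p p₁ p₀ r (suc m) m< =
    prepend-step₂ (suc k) K (λ i i< → p i (ℕ.m<n⇒m<1+n i<)) (p₁ ∘ ℕ.m<n⇒m<1+n) p₀ r m (ℕ.s≤s⁻¹ m<)

farthest : ∀ {m} (f : Fin (suc m) → ℕ) → ∃ λ i → ∀ j → f j ≤ f i
farthest {zero}  f = zero , λ { zero → ℕ.≤-refl }
farthest {suc m} f with farthest (f ∘ suc)
... | i , max with ℕ.≤-total (f zero) (f (suc i))
...   | inj₁ le = suc i , λ { zero → le ; (suc j) → max j }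
...   | inj₂ ge = zero , λ { zero → ℕ.≤-refl ; (suc j) → ℕ.≤-trans (max j) ge }

cycle-neighbours : ∀ {ℓ} (i : Fin (3 + ℓ)) →
  ∃ λ j → ∃ λ k → j ≢ k × Adj (cycle ℓ) i j × Adj (cycle ℓ) i k
cycle-neighbours {ℓ} zero = suc zero , fromℕ (2 + ℓ) , (λ ()) , inj₁ (inj₁ refl) ,
  inj₂ (inj₂ (cong suc (Fin.toℕ-fromℕ (2 + ℓ)) , refl))
cycle-neighbours {ℓ} (suc i) with suc (suc (toℕ i)) ℕ.<? 3 + ℓ
... | yes lt = fromℕ< lt , inject₁ i , distinct , inj₁ (inj₁ (Fin.toℕ-fromℕ< lt)) ,
  inj₂ (inj₁ (cong suc (sym (Fin.toℕ-inject₁ i))))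
  where
  distinct : fromℕ< lt ≢ inject₁ i
  distinct eq = ℕ.m≢1+n+m (toℕ i) {1}
    (trans (sym (Fin.toℕ-inject₁ i)) (trans (cong toℕ (sym eq)) (Fin.toℕ-fromℕ< lt)))
... | no ≮ = zero , inject₁ i , distinct , inj₁ (inj₂ (last , refl)) ,
  inj₂ (inj₁ (cong suc (sym (Fin.toℕ-inject₁ i))))
  where
  last : suc (suc (toℕ i)) ≡ 3 + ℓ
  last = ℕ.≤-antisym (s≤s (Fin.toℕ<n i)) (ℕ.≮⇒≥ ≮)
  distinct : zero ≢ inject₁ i
  distinct eq with () ← trans (sym last) (cong (λ k → suc (suc k))
    (trans (sym (Fin.toℕ-inject₁ i)) (cong toℕ (sym eq))))

lookup-unique : ∀ {A : Set} {xs : List A} → Unique xs → ∀ {i j} → lookup xs i ≡ lookup xs j → i ≡ j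
lookup-unique (x∉ ∷ u) {zero}  {zero}  _  = refl
lookup-unique (x∉ ∷ u) {zero}  {suc j} eq = contradiction eq (All.lookup x∉ (∈-lookup j))
lookup-unique (x∉ ∷ u) {suc i} {zero}  eq = contradiction (sym eq) (All.lookup x∉ (∈-lookup i))
lookup-unique (x∉ ∷ u) {suc i} {suc j} eq = cong suc (lookup-unique u eq)

-- The rotation of `C₄`; its third power is the backward rotation. On four corners every fact about
-- it is decided by enumeration.
turn : Fin 4 → Fin 4
turn zero                   = suc zero
turn (suc zero)             = suc (suc zero)
turn (suc (suc zero))       = suc (suc (suc zero))
turn (suc (suc (suc zero))) = zero

turn-adj : ∀ i → Adj C₄ i (turn i)
turn-adj = from-yes (Fin.all? λ i → adj? C₄ i (turn i))

turn-neighbour : ∀ i j → Adj C₄ i j → j ≡ turn i ⊎ j ≡ turn (turn (turn i))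
turn-neighbour = from-yes (Fin.all? λ i → Fin.all? λ j →
  adj? C₄ i j →-dec ((j Fin.≟ turn i) ⊎-dec (j Fin.≟ turn (turn (turn i)))))

turn-cases : ∀ i j → j ≡ i ⊎ j ≡ turn i ⊎ j ≡ turn (turn i) ⊎ j ≡ turn (turn (turn i))
turn-cases = from-yes (Fin.all? λ i → Fin.all? λ j → (j Fin.≟ i) ⊎-dec (j Fin.≟ turn i)
  ⊎-dec (j Fin.≟ turn (turn i)) ⊎-dec (j Fin.≟ turn (turn (turn i))))

turn⁴ : ∀ i → turn (turn (turn (turn i))) ≡ i
turn⁴ = from-yes (Fin.all? λ i → turn (turn (turn (turn i))) Fin.≟ i)

turn-≢ : ∀ i → turn i ≢ i
turn-≢ = from-yes (Fin.all? λ i → ¬? (turn i Fin.≟ i))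

turn²-≢ : ∀ i → turn (turn i) ≢ i
turn²-≢ = from-yes (Fin.all? λ i → ¬? (turn (turn i) Fin.≟ i))

turn³-≢ : ∀ i → turn (turn (turn i)) ≢ i
turn³-≢ = from-yes (Fin.all? λ i → ¬? (turn (turn (turn i)) Fin.≟ i))

-- Distances and separating edges

module Metric {n} (G : Graph n) (conn : Connected G) where

  V : Set
  V = Fin n

  -- From here on, distances are known only as lengths that are attained by a walk and minimal; the
  -- search that computes them stays sealed.
  opaque
    d : V → V → ℕ
    d = distance G conn

    d≡distance : ∀ u v → d u v ≡ distance G conn u v
    d≡distance u v = refl

    geodesic : ∀ u v → WalkOfLength G u v (d u v)
    geodesic u v = proj₁ (proj₂ (shortest G conn u v))

    d-minimal : ∀ {u v} (p : Walk G u v) → d u v ≤ walkLength p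
    d-minimal {u} {v} = proj₂ (proj₂ (shortest G conn u v))

  walkLength-◅◅ : ∀ {u v w} (p : Walk G u v) (q : Walk G v w) →
    walkLength (p ◅◅ q) ≡ walkLength p + walkLength q
  walkLength-◅◅ ε       q = refl
  walkLength-◅◅ (_ ◅ p) q = cong suc (walkLength-◅◅ p q)

  reverse-walk : ∀ {u v} (p : Walk G u v) → WalkOfLength G v u (walkLength p)
  reverse-walk ε = ε , refl
  reverse-walk (e ◅ p) with reverse-walk p
  ... | q , eq = q ◅◅ symm G e ◅ ε ,
    trans (walkLength-◅◅ q _) (trans (ℕ.+-comm _ 1) (cong suc eq))

  d-refl : ∀ u → d u u ≡ 0
  d-refl u = ℕ.n≤0⇒n≡0 (d-minimal ε)

  d≡0⇒≡ : ∀ {u v} → d u v ≡ 0 → u ≡ v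
  d≡0⇒≡ {u} {v} eq with geodesic u v
  ... | ε     , _ = refl
  ... | _ ◅ _ , eq′ with () ← trans eq′ eq

  d-sym-≤ : ∀ u v → d u v ≤ d v u
  d-sym-≤ u v with geodesic v u
  ... | p , eq with reverse-walk p
  ...   | q , eq′ = ℕ.≤-trans (d-minimal q) (ℕ.≤-reflexive (trans eq′ eq))

  d-sym : ∀ u v → d u v ≡ d v u
  d-sym u v = ℕ.≤-antisym (d-sym-≤ u v) (d-sym-≤ v u)

  d-triangle : ∀ u v w → d u w ≤ d u v + d v w
  d-triangle u v w with geodesic u v | geodesic v w
  ... | p , eq | q , eq′ =
    ℕ.≤-trans (d-minimal (p ◅◅ q)) (ℕ.≤-reflexive (trans (walkLength-◅◅ p q) (cong₂ _+_ eq eq′)))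

  d-adj : ∀ {u v} x → Adj G u v → d x v ≤ suc (d x u)
  d-adj {u} {v} x e = ℕ.≤-trans (d-triangle x u v) (ℕ.≤-trans (ℕ.+-monoʳ-≤ (d x u) (d-minimal (e ◅ ε)))
                                                            (ℕ.≤-reflexive (ℕ.+-comm (d x u) 1)))

  -- The second vertex on a geodesic from `v` to `x`. At `v = x` the default is `x` itself, in
  -- accordance with `pred 0 = 0`, so that `anc` can be iterated without side conditions.
  parent : ∀ x v → ∃ λ u → d x u ≡ pred (d x v) × (0 < d x v → Adj G u v)
  parent x v with geodesic v x
  ... | ε , eq = v , trans (d-refl v) (cong pred (sym (d-refl v))) , λ 0<d → contradiction (d-refl v) (ℕ.m<n⇒n≢0 0<d)
  ... | _◅_ {j = u} e p , eq = u , ℕ.≤-antisym near far , λ _ → symm G e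
    where
    open ≤-Reasoning
    near : d x u ≤ pred (d x v)
    near = begin
      d x u        ≡⟨ d-sym x u ⟩
      d u x        ≤⟨ d-minimal p ⟩
      walkLength p ≡⟨ cong pred (trans eq (d-sym v x)) ⟩
      pred (d x v) ∎
    far : pred (d x v) ≤ d x u
    far = ℕ.pred-mono-≤ (d-adj x (symm G e))

  par : V → V → V
  par x v = proj₁ (parent x v)

  d-par : ∀ x v → d x (par x v) ≡ pred (d x v)
  d-par x v = proj₁ (proj₂ (parent x v))

  par-adj : ∀ {x v} → 0 < d x v → Adj G (par x v) v
  par-adj {x} {v} = proj₂ (proj₂ (parent x v))

  par-rise : ∀ {x v} → 0 < d x v → d x v ≡ suc (d x (par x v))
  par-rise {x} {v} 0<d = trans (sym (ℕ.suc-pred _ ⦃ ℕ.>-nonZero 0<d ⦄)) (cong suc (sym (d-par x v)))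

  anc : V → V → ℕ → V
  anc x v zero    = v
  anc x v (suc i) = par x (anc x v i)

  d-anc : ∀ x v i → d x (anc x v i) ≡ d x v ∸ i
  d-anc x v zero    = refl
  d-anc x v (suc i) = trans (d-par x _) (trans (cong pred (d-anc x v i)) (ℕ.pred[m∸n]≡m∸[1+n] (d x v) i))

  anc-pos : ∀ {x v i} → i < d x v → 0 < d x (anc x v i)
  anc-pos {x} {v} {i} i<d = subst (0 <_) (sym (d-anc x v i)) (ℕ.m<n⇒0<n∸m i<d)

  Between : V → V → V → Set
  Between x v y = d x v + d v y ≡ d x y

  -- The step to the parent comes one closer to `x`, so the triangle inequality forces it to move
  -- one away from `y`.
  between-par : ∀ {x v y} → 0 < d x v → Between x v y → Between x (par x v) y × d (par x v) y ≡ suc (d v y)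
  between-par {x} {v} {y} 0<d btw =
    trans (cong (d x u +_) away) (trans (ℕ.+-suc _ _) (trans (cong (_+ d v y) (sym rise)) btw)) , away
    where
    u = par x v
    rise = par-rise 0<d
    away : d u y ≡ suc (d v y)
    away = ℕ.≤-antisym
      (subst₂ (λ i j → i ≤ suc j) (d-sym y u) (d-sym y v) (d-adj y (symm G (par-adj 0<d))))
      (ℕ.+-cancelˡ-≤ (d x u) _ _ (subst (_≤ d x u + d u y)
        (trans (sym btw) (trans (cong (_+ d v y) rise) (sym (ℕ.+-suc _ _))))
        (d-triangle x u y)))

  between-anc : ∀ {x v y} i → i ≤ d x v → Between x v y → Between x (anc x v i) y
  between-anc zero    _   btw = btw
  between-anc (suc i) i<d btw = proj₁ (between-par (anc-pos i<d) (between-anc i (ℕ.<⇒≤ i<d) btw))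

  -- Edges are oriented: Sep x y (a , b) says that ab separates x from y, with a on the side of x.
  Sep : V → V → V × V → Set
  Sep x y (a , b) = Adj G a b × d x b ≡ suc (d x a) × d y a ≡ suc (d y b)

  sep? : ∀ x y → Decidable (Sep x y)
  sep? x y (a , b) = adj? G a b ×-dec (d x b ℕ.≟ suc (d x a)) ×-dec (d y a ℕ.≟ suc (d y b))

  separators : V → V → List (V × V)
  separators x y = filter (sep? x y) (cartesianProduct (allFin n) (allFin n))

  separators-unique : ∀ x y → Unique (separators x y)
  separators-unique x y = Unique.filter⁺ (sep? x y) (Unique.cartesianProduct⁺ (Unique.allFin⁺ n) (Unique.allFin⁺ n))

  ∈-separators : ∀ {x y e} → Sep x y e → e ∈ separators x y
  ∈-separators {x} {y} = ∈-filter⁺ (sep? x y) (∈-cartesianProduct⁺ (∈-allFin _) (∈-allFin _))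

  μ : V → V → ℕ
  μ x y = length (separators x y)

  μ≡sum : ∀ x y → μ x y ≡ ∑[ a < n ] ∑[ b < n ] ⟦ sep? x y (a , b) ⟧
  μ≡sum x y = trans (length-as-sum (separators x y))
    (trans (sum-map-filter-pairs (sep? x y) (λ _ → 1))
      (sum-cong-≗ {n} λ a → sum-cong-≗ {n} λ b → ℕ.*-identityʳ ⟦ sep? x y (a , b) ⟧))

  flip-sep : ∀ {x y a b} → Sep x y (a , b) → Sep y x (b , a)
  flip-sep (e , p , q) = symm G e , q , p

  μ-sym : ∀ x y → μ x y ≡ μ y x
  μ-sym x y = trans (μ≡sum x y) (trans (∑-comm (λ a b → ⟦ sep? x y (a , b) ⟧)) (trans
    (sum-cong-≗ {n} λ b → sum-cong-≗ {n} λ a →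
      ⟦⟧-cong (sep? x y (a , b)) (sep? y x (b , a)) flip-sep flip-sep)
    (sym (μ≡sum y x))))

  geodesicEdge : V → V → ℕ → V × V
  geodesicEdge x v i = anc x v (suc i) , anc x v i

  geodesicEdges : V → V → List (V × V)
  geodesicEdges x v = applyUpTo (geodesicEdge x v) (d x v)

  geodesicEdges-sep : ∀ {x v y} → Between x v y → All (Sep x y) (geodesicEdges x v)
  geodesicEdges-sep {x} {v} {y} btw = All.applyUpTo⁺₁ _ _ λ {i} i<d →
    par-adj (anc-pos i<d) , par-rise (anc-pos i<d) ,
    trans (d-sym y _) (trans (proj₂ (between-par (anc-pos i<d) (between-anc i (ℕ.<⇒≤ i<d) btw))) (cong suc (d-sym _ y)))

  geodesicEdges-unique : ∀ x v → Unique (geodesicEdges x v)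
  geodesicEdges-unique x v = Unique.applyUpTo⁺₁ _ _ λ {i} {j} i<j j<d eq →
    contradiction
      (ℕ.∸-cancelˡ-≡ (ℕ.<⇒≤ (ℕ.<-trans i<j j<d)) (ℕ.<⇒≤ j<d)
        (trans (sym (d-anc x v i)) (trans (cong (d x ∘ proj₂) eq) (d-anc x v j))))
      (ℕ.<⇒≢ i<j)

  -- As `v` lies on a geodesic from `x` to `y`, all `d x v` edges of the geodesic from `x` to `v`
  -- separate `x` from `y`; those in `L` come on top.
  μ-lower : ∀ {x v y L} → Between x v y → Unique L → All (Sep x y) L → Disjoint L (geodesicEdges x v) →
    length L + d x v ≤ μ x y
  μ-lower {x} {v} {y} {L} btw uL sL disj = begin
    length L + d x v                       ≡⟨ cong (length L +_) (length-applyUpTo (geodesicEdge x v) (d x v)) ⟨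
    length L + length (geodesicEdges x v)  ≡⟨ length-++ L ⟨
    length (L ++ geodesicEdges x v)        ≤⟨ length-mono-⊆ (Unique.++⁺ uL (geodesicEdges-unique x v) disj) ⊆sep ⟩
    μ x y                                  ∎
    where
    open ≤-Reasoning
    ⊆sep : ∀ {e} → e ∈ L ++ geodesicEdges x v → e ∈ separators x y
    ⊆sep e∈ with ∈-++⁻ L e∈
    ... | inj₁ e∈L = ∈-separators (All.lookup sL e∈L)
    ... | inj₂ e∈g = ∈-separators (All.lookup (geodesicEdges-sep btw) e∈g)

  between-end : ∀ x y → Between x y y
  between-end x y = trans (cong (d x y +_) (d-refl y)) (ℕ.+-identityʳ _)

  d≤μ : ∀ x y → d x y ≤ μ x y
  d≤μ x y = μ-lower {L = []} (between-end x y) [] [] (λ ())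

  -- Below level s one separating edge per level is supplied by a geodesic.
  μ-lower-above : ∀ {x y L} s → s ≤ d x y → Unique L → All (Sep x y) L → All (λ e → s < d x (proj₂ e)) L →
    length L + s ≤ μ x y
  μ-lower-above {x} {y} {L} s s≤d uL sL above =
    subst (λ k → length L + k ≤ μ x y) d≡s (μ-lower (between-anc i (ℕ.m∸n≤m _ s) (between-end x y)) uL sL disj)
    where
    i = d x y ∸ s
    v = anc x y i
    d≡s : d x v ≡ s
    d≡s = trans (d-anc x y i) (ℕ.m∸[m∸n]≡n s≤d)
    disj : Disjoint L (geodesicEdges x v)
    disj (e∈L , e∈g) with ∈-applyUpTo⁻ (geodesicEdge x v) e∈g
    ... | j , _ , refl = ℕ.<⇒≱ (All.lookup above e∈L)
      (ℕ.≤-trans (ℕ.≤-reflexive (d-anc x v j)) (ℕ.≤-trans (ℕ.m∸n≤m _ j) (ℕ.≤-reflexive d≡s)))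

  _≟ᵉ_ : (e f : V × V) → Dec (e ≡ f)
  _≟ᵉ_ = ≡-dec Fin._≟_ Fin._≟_

  open import Data.List.Membership.DecPropositional _≟ᵉ_ using (_∈?_)

  -- A separating edge off the chosen geodesic could be added to the `d x y` edges on it and would
  -- create excess.
  tight-on-geodesic : ∀ {x y e} → μ x y ≤ d x y → Sep x y e →
    ∃ λ i → i < d x y × e ≡ geodesicEdge x y i
  tight-on-geodesic {x} {y} {e} tight sep with e ∈? geodesicEdges x y
  ... | yes e∈ = ∈-applyUpTo⁻ (geodesicEdge x y) e∈
  ... | no e∉  = contradiction (ℕ.≤-trans (μ-lower {L = e ∷ []} (between-end x y) ([] ∷ []) (sep ∷ [])
      λ { (here refl , e∈) → e∉ e∈ }) tight) ℕ.1+n≰n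

  tight-level-unique : ∀ {x y a b a′ b′} → μ x y ≤ d x y → Sep x y (a , b) → Sep x y (a′ , b′) →
    d x b ≡ d x b′ → (a , b) ≡ (a′ , b′)
  tight-level-unique {x} {y} tight s s′ eq with tight-on-geodesic tight s | tight-on-geodesic tight s′
  ... | i , i<d , refl | j , j<d , refl
    with refl ← ℕ.∸-cancelˡ-≡ (ℕ.<⇒≤ i<d) (ℕ.<⇒≤ j<d) (trans (sym (d-anc x y i)) (trans eq (d-anc x y j))) = refl

  tight-consecutive : ∀ {x y a b a′ b′} → μ x y ≤ d x y → Sep x y (a , b) → Sep x y (a′ , b′) →
    d x b ≡ d x a′ → b ≡ a′
  tight-consecutive {x} {y} tight s s′ eq with tight-on-geodesic tight s | tight-on-geodesic tight s′
  ... | i , i<d , refl | j , j<d , refl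
    with refl ← ℕ.∸-cancelˡ-≡ (ℕ.<⇒≤ i<d) j<d (trans (sym (d-anc x y i)) (trans eq (d-anc x y (suc j)))) = refl

  -- Excess of the separating edges over the distance

  excess : V → V → ℕ
  excess x y = μ x y ∸ d x y

  excess-sym : ∀ x y → excess x y ≡ excess y x
  excess-sym x y = cong₂ _∸_ (μ-sym x y) (d-sym x y)

  d+excess : ∀ x y → d x y + excess x y ≡ μ x y
  d+excess x y = ℕ.m+[n∸m]≡n (d≤μ x y)

  excess-lower : ∀ {x y} k → k + d x y ≤ μ x y → k ≤ excess x y
  excess-lower {x} {y} k = ℕ.m+n≤o⇒m≤o∸n k

  excess-upper : ∀ {x y} k → μ x y ≤ d x y + k → excess x y ≤ k
  excess-upper {x} {y} k = ℕ.m≤n+o⇒m∸n≤o (μ x y) (d x y)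

  excess-zero : ∀ {x y} → excess x y ≤ 0 → μ x y ≤ d x y
  excess-zero {x} {y} ex = ℕ.m∸n≡0⇒m≤n (ℕ.n≤0⇒n≡0 ex)

  totalExcess : ℕ
  totalExcess = ∑[ x < n ] ∑[ y < n ] excess x y

  wiener-double : 2 ℕ.* wiener G conn ≡ ∑[ x < n ] ∑[ y < n ] d x y
  wiener-double = trans (cong (2 ℕ.*_) (trans
      (sum-map-filter-pairs {n} (λ (u , v) → u Fin.<? v) (λ (u , v) → distance G conn u v))
      (sum-cong-≗ {n} λ u → sum-cong-≗ {n} λ v → cong (⟦ u Fin.<? v ⟧ ℕ.*_) (sym (d≡distance u v)))))
    (double-sum-pairs d d-sym d-refl)

  sum-map-edges : (f : V × V → ℕ) → List.sum (map f (edges G)) ≡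
    ∑[ u < n ] ∑[ v < n ] (⟦ u Fin.<? v ⟧ ℕ.* (⟦ adj? G u v ⟧ ℕ.* f (u , v)))
  sum-map-edges f = trans (sum-map-filter (λ (u , v) → adj? G u v) f (pairs n))
    (sum-map-filter-pairs {n} (λ (u , v) → u Fin.<? v) (λ (u , v) → ⟦ adj? G u v ⟧ ℕ.* f (u , v)))

  size-double : 2 ℕ.* size G ≡ ∑[ u < n ] ∑[ v < n ] ⟦ adj? G u v ⟧
  size-double = trans (cong (2 ℕ.*_) (trans (length-as-sum (edges G)) (trans (sum-map-edges (λ _ → 1))
      (sum-cong-≗ {n} λ u → sum-cong-≗ {n} λ v → cong (⟦ u Fin.<? v ⟧ ℕ.*_) (ℕ.*-identityʳ ⟦ adj? G u v ⟧)))))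
    (double-sum-pairs (λ u v → ⟦ adj? G u v ⟧)
      (λ u v → ⟦⟧-cong (adj? G u v) (adj? G v u) (symm G) (symm G))
      (λ u → ⟦⟧-no (adj? G u u) (irrefl G)))

  adj-< : ∀ {u v} x → Adj G u v → d x u < d x v → d x v ≡ suc (d x u)
  adj-< x e u<v = ℕ.≤-antisym (d-adj x e) u<v

  -- Each product becomes a sum over pairs (x, y), and the edge sums are moved inside. Distances
  -- change by at most one along an edge, which turns the strict inequalities of `closer` into the
  -- exact steps of `Sep`.
  szeged-double : 2 ℕ.* szeged G conn ≡ ∑[ x < n ] ∑[ y < n ] μ x y
  szeged-double = begin
    2 ℕ.* szeged G conn
      ≡⟨ cong (2 ℕ.*_) (sum-map-edges _) ⟩
    2 ℕ.* ∑[ u < n ] ∑[ v < n ] (⟦ u Fin.<? v ⟧ ℕ.* f u v)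
      ≡⟨ double-sum-pairs f f-sym (λ u →
           cong (ℕ._* (closer G conn u u ℕ.* closer G conn u u)) (⟦⟧-no (adj? G u u) (irrefl G))) ⟩
    ∑[ u < n ] ∑[ v < n ] f u v
      ≡⟨ sum-cong-≗ {n} (λ u → sum-cong-≗ {n} (λ v → expand u v)) ⟩
    ∑[ u < n ] ∑[ v < n ] ∑[ x < n ] ∑[ y < n ] s u v x y
      ≡⟨ sum-cong-≗ {n} (λ u → ∑-comm (λ v x → ∑[ y < n ] s u v x y)) ⟩
    ∑[ u < n ] ∑[ x < n ] ∑[ v < n ] ∑[ y < n ] s u v x y
      ≡⟨ ∑-comm (λ u x → ∑[ v < n ] ∑[ y < n ] s u v x y) ⟩
    ∑[ x < n ] ∑[ u < n ] ∑[ v < n ] ∑[ y < n ] s u v x y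
      ≡⟨ sum-cong-≗ {n} (λ x → sum-cong-≗ {n} (λ u → ∑-comm (λ v y → s u v x y))) ⟩
    ∑[ x < n ] ∑[ u < n ] ∑[ y < n ] ∑[ v < n ] s u v x y
      ≡⟨ sum-cong-≗ {n} (λ x → ∑-comm (λ u y → ∑[ v < n ] s u v x y)) ⟩
    ∑[ x < n ] ∑[ y < n ] ∑[ u < n ] ∑[ v < n ] s u v x y
      ≡⟨ sum-cong-≗ {n} (λ x → sum-cong-≗ {n} (λ y → μ≡sum x y)) ⟨
    ∑[ x < n ] ∑[ y < n ] μ x y ∎
    where
    open ≡-Reasoning
    s : V → V → V → V → ℕ
    s u v x y = ⟦ sep? x y (u , v) ⟧
    f : V → V → ℕ
    f u v = ⟦ adj? G u v ⟧ ℕ.* (closer G conn u v ℕ.* closer G conn v u)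
    f-sym : ∀ u v → f u v ≡ f v u
    f-sym u v = cong₂ ℕ._*_ (⟦⟧-cong (adj? G u v) (adj? G v u) (symm G) (symm G))
                            (ℕ.*-comm (closer G conn u v) _)
    near? : ∀ u v w → Dec (distance G conn u w < distance G conn v w)
    near? u v w = distance G conn u w ℕ.<? distance G conn v w
    to-< : ∀ {u v} w → distance G conn u w < distance G conn v w → d w u < d w v
    to-< {u} {v} w = subst₂ _<_ (trans (sym (d≡distance u w)) (d-sym u w)) (trans (sym (d≡distance v w)) (d-sym v w))
    from-< : ∀ {u v} w → d w u < d w v → distance G conn u w < distance G conn v w
    from-< {u} {v} w = subst₂ _<_ (trans (d-sym w u) (d≡distance u w)) (trans (d-sym w v) (d≡distance v w))
    to-sep : ∀ {u v x y} →
      Adj G u v × distance G conn u x < distance G conn v x × distance G conn v y < distance G conn u y →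
      Sep x y (u , v)
    to-sep {x = x} {y} (e , p , q) = e , adj-< x e (to-< x p) , adj-< y (symm G e) (to-< y q)
    from-sep : ∀ {u v x y} → Sep x y (u , v) →
      Adj G u v × distance G conn u x < distance G conn v x × distance G conn v y < distance G conn u y
    from-sep {x = x} {y} (e , p , q) =
      e , from-< x (ℕ.≤-reflexive (sym p)) , from-< y (ℕ.≤-reflexive (sym q))
    pointwise : ∀ u v x y → ⟦ adj? G u v ⟧ ℕ.* (⟦ near? u v x ⟧ ℕ.* ⟦ near? v u y ⟧) ≡ s u v x y
    pointwise u v x y = trans (cong (⟦ adj? G u v ⟧ ℕ.*_) (⟦⟧-× (near? u v x) (near? v u y)))
      (trans (⟦⟧-× (adj? G u v) (near? u v x ×-dec near? v u y))
        (⟦⟧-cong (adj? G u v ×-dec near? u v x ×-dec near? v u y) (sep? x y (u , v)) to-sep from-sep))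
    expand : ∀ u v → f u v ≡ ∑[ x < n ] ∑[ y < n ] s u v x y
    expand u v = begin
      ⟦ adj? G u v ⟧ ℕ.* (closer G conn u v ℕ.* closer G conn v u)
        ≡⟨ cong (⟦ adj? G u v ⟧ ℕ.*_) 
             (cong₂ ℕ._*_ (length-filter-allFin (near? u v)) (length-filter-allFin (near? v u))) ⟩
      ⟦ adj? G u v ⟧ ℕ.* ((∑[ x < n ] ⟦ near? u v x ⟧) ℕ.* (∑[ y < n ] ⟦ near? v u y ⟧))
        ≡⟨ cong (⟦ adj? G u v ⟧ ℕ.*_) (trans (*-distribʳ-sum _ (λ x → ⟦ near? u v x ⟧))
             (sum-cong-≗ {n} (λ x → *-distribˡ-sum ⟦ near? u v x ⟧ (λ y → ⟦ near? v u y ⟧)))) ⟩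
      ⟦ adj? G u v ⟧ ℕ.* ∑[ x < n ] ∑[ y < n ] (⟦ near? u v x ⟧ ℕ.* ⟦ near? v u y ⟧)
        ≡⟨ trans (*-distribˡ-sum ⟦ adj? G u v ⟧ (λ x → ∑[ y < n ] (⟦ near? u v x ⟧ ℕ.* ⟦ near? v u y ⟧)))
             (sum-cong-≗ {n} (λ x → *-distribˡ-sum ⟦ adj? G u v ⟧ (λ y → ⟦ near? u v x ⟧ ℕ.* ⟦ near? v u y ⟧))) ⟩
      ∑[ x < n ] ∑[ y < n ] (⟦ adj? G u v ⟧ ℕ.* (⟦ near? u v x ⟧ ℕ.* ⟦ near? v u y ⟧))
        ≡⟨ sum-cong-≗ {n} (λ x → sum-cong-≗ {n} (λ y → pointwise u v x y)) ⟩
      ∑[ x < n ] ∑[ y < n ] s u v x y ∎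

  szeged-wiener : 2 ℕ.* szeged G conn ≡ 2 ℕ.* wiener G conn + totalExcess
  szeged-wiener = begin
    2 ℕ.* szeged G conn
      ≡⟨ szeged-double ⟩
    ∑[ x < n ] ∑[ y < n ] μ x y
      ≡⟨ sum-cong-≗ {n} (λ x → trans (sum-cong-≗ {n} (λ y → sym (d+excess x y))) (∑-distrib-+ (d x) (excess x))) ⟩
    ∑[ x < n ] (∑[ y < n ] d x y + ∑[ y < n ] excess x y)
      ≡⟨ ∑-distrib-+ (λ x → ∑[ y < n ] d x y) (λ x → ∑[ y < n ] excess x y) ⟩
    (∑[ x < n ] ∑[ y < n ] d x y) + totalExcess
      ≡⟨ cong (_+ totalExcess) wiener-double ⟨
    2 ℕ.* wiener G conn + totalExcess ∎
    where open ≡-Reasoning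

-- Bipartite graphs: parity of distances

module BipartiteMetric {n} (G : Graph n) (conn : Connected G) (bip : Bipartite G) where

  open Metric G conn public

  flips : ℕ → Bool → Bool
  flips zero    c = c
  flips (suc k) c = flips k (not c)

  colour-walk : ∀ {u v} (p : Walk G u v) → proj₁ bip v ≡ flips (walkLength p) (proj₁ bip u)
  colour-walk ε       = refl
  colour-walk (e ◅ p) = trans (colour-walk p) (cong (flips (walkLength p)) (¬-not (proj₂ bip (symm G e))))

  -- Walks of equal length from `x` end in the same colour, but the ends of an edge have different
  -- colours.
  adj-≢ : ∀ {u v} x → Adj G u v → d x u ≢ d x v
  adj-≢ {u} {v} x e eq with geodesic x u | geodesic x v
  ... | p , p≡ | q , q≡ = proj₂ bip e (trans (colour-walk p)
    (trans (cong (λ k → flips k (proj₁ bip x)) (trans p≡ (trans eq (sym q≡)))) (sym (colour-walk q))))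

  adj-step : ∀ {u v} x → Adj G u v → d x v ≡ suc (d x u) ⊎ d x u ≡ suc (d x v)
  adj-step {u} {v} x e with ℕ.<-cmp (d x u) (d x v)
  ... | tri< u<v _ _ = inj₁ (adj-< x e u<v)
  ... | tri≈ _ eq _  = contradiction eq (adj-≢ x e)
  ... | tri> _ _ v<u = inj₂ (adj-< x (symm G e) v<u)

  d-one : ∀ {u v} → Adj G u v → d u v ≡ 1
  d-one {u} e with adj-step u e
  ... | inj₁ eq = trans eq (cong suc (d-refl u))
  ... | inj₂ eq with () ← trans (sym (d-refl u)) eq

  d-two : ∀ {u v w} → Adj G u v → Adj G v w → u ≢ w → d u w ≡ 2
  d-two {u} uv vw u≢w with adj-step u vw
  ... | inj₁ eq = trans eq (cong suc (d-one uv))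
  ... | inj₂ eq = contradiction (d≡0⇒≡ (sym (ℕ.suc-injective (trans (sym (d-one uv)) eq)))) u≢w

  d≡1⇒adj : ∀ {u v} → d u v ≡ 1 → Adj G u v
  d≡1⇒adj {u} {v} eq with geodesic u v
  ... | ε         , eq′ with () ← trans eq′ eq
  ... | e ◅ ε     , _   = e
  ... | _ ◅ _ ◅ _ , eq′ with () ← trans eq′ eq

  rise-asym : ∀ {i j : ℕ} → i ≡ suc j → j ≢ suc i
  rise-asym refl ()

  rise⇒≢ : ∀ {x u v} → d x v ≡ suc (d x u) → v ≢ u
  rise⇒≢ eq refl = ℕ.1+n≢n (sym eq)

  rise₂⇒≢ : ∀ {x u v w} → d x v ≡ suc (d x u) → d x w ≡ suc (d x v) → w ≢ u
  rise₂⇒≢ eq eq′ refl = ℕ.<⇒≢ (ℕ.m<n⇒m<1+n (ℕ.n<1+n _)) (trans eq′ (cong suc eq))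

  -- An edge between `x` and `z` has `y` strictly on one side: if `y` is on the side of `x`, the
  -- edge separates `y` from `z`, otherwise `x` from `y`. All upper bounds on excess rest on this.
  μ-triangle : ∀ x y z → μ x z ≤ μ x y + μ y z
  μ-triangle x y z = length-filter-⊎ (sep? x z) (sep? x y) (sep? y z) side (cartesianProduct (allFin n) (allFin n))
    where
    side : ∀ {e} → Sep x z e → Sep x y e ⊎ Sep y z e
    side (e , p , q) with adj-step y e
    ... | inj₁ r = inj₂ (e , r , q)
    ... | inj₂ r = inj₁ (e , p , r)

  sep-last : ∀ {x y u} → Adj G u y → d x y ≡ suc (d x u) → Sep x y (u , y)
  sep-last {y = y} uy rise = uy , rise , trans (d-one (symm G uy)) (cong suc (sym (d-refl y)))

  -- Distinct neighbours of `v` are at distance exactly two, so seen from `y` the edge `uv` leads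
  -- away; it need not lie on a geodesic from `x` to `y`.
  sep-last₂ : ∀ {x y u v} → Adj G u v → Adj G v y → u ≢ y → d x v ≡ suc (d x u) → Sep x y (u , v)
  sep-last₂ uv vy u≢y rise =
    uv , rise , trans (d-two (symm G vy) (symm G uv) (u≢y ∘ sym)) (cong suc (sym (d-one (symm G vy))))

  -- Two parents

  Parent : V → V → V → Set
  Parent x u v = Adj G u v × d x v ≡ suc (d x u)

  parent? : ∀ x u v → Dec (Parent x u v)
  parent? x u v = adj? G u v ×-dec (d x v ℕ.≟ suc (d x u))

  record TwoParents (x y u₁ u₂ : V) : Set where
    field
      parent₁ : Parent x u₁ y
      parent₂ : Parent x u₂ y
      u₁≢u₂   : u₁ ≢ u₂

  twoParents? : ∀ x y u₁ u₂ → Dec (TwoParents x y u₁ u₂)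
  twoParents? x y u₁ u₂ = map′
    (λ (p , q , r) → record { parent₁ = p ; parent₂ = q ; u₁≢u₂ = r })
    (λ t → let open TwoParents t in parent₁ , parent₂ , u₁≢u₂)
    (parent? x u₁ y ×-dec parent? x u₂ y ×-dec ¬? (u₁ Fin.≟ u₂))

  -- No edge is level with respect to `x`, so each edge is counted once, at its farther end.
  size≡parents : ∀ x → size G ≡ ∑[ v < n ] ∑[ u < n ] ⟦ parent? x u v ⟧
  size≡parents x = ℕ.*-cancelˡ-≡ (size G) S 2 $ begin
    2 ℕ.* size G
      ≡⟨ size-double ⟩
    ∑[ v < n ] ∑[ u < n ] ⟦ adj? G v u ⟧
      ≡⟨ sum-cong-≗ {n} (λ v → trans (sum-cong-≗ {n} (pointwise v)) (∑-distrib-+ (λ u → ⟦ parent? x u v ⟧) _)) ⟩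
    ∑[ v < n ] (∑[ u < n ] ⟦ parent? x u v ⟧ + ∑[ u < n ] ⟦ parent? x v u ⟧)
      ≡⟨ ∑-distrib-+ (λ v → ∑[ u < n ] ⟦ parent? x u v ⟧) _ ⟩
    S + ∑[ v < n ] ∑[ u < n ] ⟦ parent? x v u ⟧
      ≡⟨ cong (S +_) (∑-comm (λ v u → ⟦ parent? x v u ⟧)) ⟩
    S + S
      ≡⟨ cong (S +_) (ℕ.+-identityʳ S) ⟨
    2 ℕ.* S ∎
    where
    open ≡-Reasoning
    S = ∑[ v < n ] ∑[ u < n ] ⟦ parent? x u v ⟧
    pointwise : ∀ v u → ⟦ adj? G v u ⟧ ≡ ⟦ parent? x u v ⟧ + ⟦ parent? x v u ⟧
    pointwise v u = by-adjacency (adj? G v u)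
      where
      by-adjacency : Dec (Adj G v u) → ⟦ adj? G v u ⟧ ≡ ⟦ parent? x u v ⟧ + ⟦ parent? x v u ⟧
      by-adjacency (no ¬e) = trans (⟦⟧-no (adj? G v u) ¬e)
        (sym (cong₂ _+_ (⟦⟧-no (parent? x u v) (¬e ∘ symm G ∘ proj₁)) (⟦⟧-no (parent? x v u) (¬e ∘ proj₁))))
      by-adjacency (yes e) with adj-step x e
      ... | inj₁ up = trans (⟦⟧-yes (adj? G v u) e)
        (sym (cong₂ _+_ (⟦⟧-no (parent? x u v) (rise-asym up ∘ proj₂)) (⟦⟧-yes (parent? x v u) (e , up))))
      ... | inj₂ down = trans (⟦⟧-yes (adj? G v u) e)
        (sym (cong₂ _+_ (⟦⟧-yes (parent? x u v) (symm G e , down)) (⟦⟧-no (parent? x v u) (rise-asym down ∘ proj₂))))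

  -- Otherwise every vertex has at most one parent; as there are at least `n` edges, each has
  -- exactly one, but `x` has none.
  two-parents-exist : n ≤ size G → ∀ x → ∃ λ y → ∃ λ u₁ → ∃ λ u₂ → TwoParents x y u₁ u₂
  two-parents-exist n≤m x with Fin.any? (λ y → Fin.any? λ u₁ → Fin.any? λ u₂ → twoParents? x y u₁ u₂)
  ... | yes found = found
  ... | no none = contradiction (sum-tight at-most-one many x) (ℕ.<⇒≱ (ℕ.≤-reflexive (cong suc root)))
    where
    open ≤-Reasoning
    parents : V → ℕ
    parents v = ∑[ u < n ] ⟦ parent? x u v ⟧
    short : ∀ v (us : List V) → (∀ {u} → u ∈ us → Parent x u v) → Unique us → length us ≤ 1
    short v []       _  _ = z≤n
    short v (u ∷ us) ps uus = length-mono-⊆ {ys = u ∷ []} uus same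
      where
      same : ∀ {w} → w ∈ u ∷ us → w ∈ u ∷ []
      same {w} w∈ with w Fin.≟ u
      ... | yes w≡u = here w≡u
      ... | no w≢u  = contradiction
        (v , w , u , record { parent₁ = ps w∈ ; parent₂ = ps (here refl) ; u₁≢u₂ = w≢u }) none
    at-most-one : ∀ v → parents v ≤ 1
    at-most-one v = subst (_≤ 1) (length-filter-allFin (λ u → parent? x u v))
      (short v (filter (λ u → parent? x u v) (allFin n))
        (λ u∈ → proj₂ (∈-filter⁻ (λ u → parent? x u v) {xs = allFin n} u∈))
        (Unique.filter⁺ (λ u → parent? x u v) (Unique.allFin⁺ n)))
    many : ∑[ v < n ] 1 ≤ sum parents
    many = begin
      ∑[ v < n ] 1 ≡⟨ trans (sum-const n 1) (ℕ.*-identityʳ n) ⟩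
      n            ≤⟨ n≤m ⟩
      size G       ≡⟨ size≡parents x ⟩
      sum parents  ∎
    root : parents x ≡ 0
    root = trans (sum-cong-≗ {n} (λ u → ⟦⟧-no (parent? x u x) (λ (_ , eq) → ℕ.0≢1+n (trans (sym (d-refl x)) eq))))
                 (trans (sum-const n 0) (ℕ.*-zeroʳ n))

  record Square (a b c e : V) : Set where
    field
      ab  : Adj G a b
      bc  : Adj G b c
      ce  : Adj G c e
      ea  : Adj G e a
      a≢c : a ≢ c
      b≢e : b ≢ e

  square? : ∀ a b c e → Dec (Square a b c e)
  square? a b c e = map′
    (λ (ab , bc , ce , ea , a≢c , b≢e) → record { ab = ab ; bc = bc ; ce = ce ; ea = ea ; a≢c = a≢c ; b≢e = b≢e })
    (λ s → let open Square s in ab , bc , ce , ea , a≢c , b≢e)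
    (adj? G a b ×-dec adj? G b c ×-dec adj? G c e ×-dec adj? G e a ×-dec ¬? (a Fin.≟ c) ×-dec ¬? (b Fin.≟ e))

  rotate : ∀ {a b c e} → Square a b c e → Square b c e a
  rotate s = let open Square s in record { ab = bc ; bc = ce ; ce = ea ; ea = ab ; a≢c = b≢e ; b≢e = a≢c ∘ sym }

  mirror : ∀ {a b c e} → Square a b c e → Square a e c b
  mirror s = let open Square s in record
    { ab = symm G ea ; bc = symm G ce ; ce = symm G bc ; ea = symm G ab ; a≢c = a≢c ; b≢e = b≢e ∘ sym }

  -- Graphs without 4-cycles

  module _ (no-square : ∀ {a b c e} → ¬ Square a b c e) (x : V) where

    module Below {y u₁ u₂} (t : TwoParents x y u₁ u₂) where

      open TwoParents t

      w₁ = par x u₁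

      u₁y = proj₁ parent₁
      u₂y = proj₁ parent₂
      rise₁ = proj₂ parent₁
      rise₂ = proj₂ parent₂

      level : d x u₁ ≡ d x u₂
      level = ℕ.suc-injective (trans (sym rise₁) rise₂)

      -- Otherwise `u₁` and `u₂`, being on one level, would both be `x`.
      u₁-pos : 0 < d x u₁
      u₁-pos = ℕ.n≢0⇒n>0 λ eq → u₁≢u₂ (trans (sym (d≡0⇒≡ eq)) (d≡0⇒≡ (trans (sym level) eq)))

      w₁u₁ : Adj G w₁ u₁
      w₁u₁ = par-adj u₁-pos

      w-rise₁ : d x u₁ ≡ suc (d x w₁)
      w-rise₁ = par-rise u₁-pos

      y≢w₁ : y ≢ w₁
      y≢w₁ = rise₂⇒≢ w-rise₁ rise₁

      w₁≁u₂ : ¬ Adj G w₁ u₂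
      w₁≁u₂ w₁u₂ = no-square record
        { ab = symm G u₁y ; bc = symm G w₁u₁ ; ce = w₁u₂ ; ea = u₂y ; a≢c = y≢w₁ ; b≢e = u₁≢u₂ }

      -- `w₁` has distance 2 from `y` and, not being adjacent to `u₂`, distance 3 from `u₂`. So the
      -- edge `u₂y`, farther from `x` than `w₁`, still separates the two.
      excess-grandparent : 1 ≤ excess x w₁
      excess-grandparent = excess-lower 1 $
        μ-lower-above {L = (u₂ , y) ∷ []} (d x w₁) ℕ.≤-refl ([] ∷ []) ((u₂y , rise₂ , far) ∷ [])
          (subst (d x w₁ <_) (sym (trans rise₁ (cong suc w-rise₁))) (ℕ.m<n⇒m<1+n (ℕ.n<1+n _)) ∷ [])
        where
        d-w₁y = d-two w₁u₁ u₁y (y≢w₁ ∘ sym)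
        far : d w₁ u₂ ≡ suc (d w₁ y)
        far with adj-step w₁ (symm G u₂y)
        ... | inj₁ eq = eq
        ... | inj₂ eq = contradiction (d≡1⇒adj (sym (ℕ.suc-injective (trans (sym d-w₁y) eq)))) w₁≁u₂

    swap-parents : ∀ {y u₁ u₂} → TwoParents x y u₁ u₂ → TwoParents x y u₂ u₁
    swap-parents t = let open TwoParents t in record { parent₁ = parent₂ ; parent₂ = parent₁ ; u₁≢u₂ = u₁≢u₂ ∘ sym }

    -- Above the level of `w₁` the distance accounts for one edge, but three separate: `w₁u₁`,
    -- `u₂y`, and the edge from `u₂` down to its parent. The last one does because that parent is at
    -- distance 3 from `u₁`, a 4-cycle being absent.
    excess-parent : ∀ {y u₁ u₂} → TwoParents x y u₁ u₂ → 2 ≤ excess x u₁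
    excess-parent {y} {u₁} {u₂} t = excess-lower 2 $ subst (λ k → 2 + k ≤ μ x u₁) (sym I.w-rise₁) $
      μ-lower-above {L = (I.w₁ , u₁) ∷ (u₂ , y) ∷ (II.w₁ , u₂) ∷ []} (d x I.w₁)
        (ℕ.≤-trans (ℕ.n≤1+n _) (ℕ.≤-reflexive (sym I.w-rise₁)))
        (((u₁≢y ∘ cong proj₂) ∷ (u₁≢u₂ ∘ cong proj₂) ∷ []) ∷ ((u₂≢y ∘ sym ∘ cong proj₂) ∷ []) ∷ [] ∷ [])
        (sep-last I.w₁u₁ I.w-rise₁
          ∷ sep-last₂ I.u₂y (symm G I.u₁y) (u₁≢u₂ ∘ sym) I.rise₂
          ∷ (II.w₁u₁ , II.w-rise₁ , far) ∷ [])
        ( ℕ.≤-reflexive (sym I.w-rise₁)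
        ∷ subst (d x I.w₁ <_) (sym (trans I.rise₁ (cong suc I.w-rise₁))) (ℕ.m<n⇒m<1+n (ℕ.n<1+n _))
        ∷ ℕ.≤-reflexive (trans (sym I.w-rise₁) I.level) ∷ [])
      where
      module I = Below t
      module II = Below (swap-parents t)
      open TwoParents t using (u₁≢u₂)
      u₁≢y : u₁ ≢ y
      u₁≢y = rise⇒≢ I.rise₁ ∘ sym
      u₂≢y : u₂ ≢ y
      u₂≢y = rise⇒≢ I.rise₂ ∘ sym
      far : d u₁ II.w₁ ≡ suc (d u₁ u₂)
      far with adj-step u₁ (symm G II.w₁u₁)
      ... | inj₁ eq = eq
      ... | inj₂ eq = contradiction
        (symm G (d≡1⇒adj (sym (ℕ.suc-injective (trans (sym (d-two I.u₁y (symm G I.u₂y) u₁≢u₂)) eq))))) II.w₁≁u₂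

    -- Two levels below `y` the descents through `u₁` and `u₂` contribute four separating edges,
    -- where the distance accounts for two.
    excess-child : ∀ {y u₁ u₂} → TwoParents x y u₁ u₂ → 2 ≤ excess x y
    excess-child {y} {u₁} {u₂} t = excess-lower 2 $ subst (λ k → 2 + k ≤ μ x y) (sym dy) $
      μ-lower-above {L = (u₁ , y) ∷ (u₂ , y) ∷ (I.w₁ , u₁) ∷ (II.w₁ , u₂) ∷ []} (d x I.w₁)
        (subst (d x I.w₁ ≤_) (sym dy) (ℕ.m≤n⇒m≤1+n (ℕ.n≤1+n _)))
        ( ((u₁≢u₂ ∘ cong proj₁) ∷ (y≢u₁ ∘ cong proj₂) ∷ (y≢u₂ ∘ cong proj₂) ∷ [])
        ∷ ((y≢u₁ ∘ cong proj₂) ∷ (y≢u₂ ∘ cong proj₂) ∷ [])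
        ∷ ((u₁≢u₂ ∘ cong proj₂) ∷ [])
        ∷ [] ∷ [])
        ( sep-last I.u₁y I.rise₁ ∷ sep-last I.u₂y I.rise₂
        ∷ sep-last₂ I.w₁u₁ I.u₁y (I.y≢w₁ ∘ sym) I.w-rise₁
        ∷ sep-last₂ II.w₁u₁ II.u₁y (II.y≢w₁ ∘ sym) II.w-rise₁ ∷ [])
        ( above ∷ above ∷ ℕ.≤-reflexive (sym I.w-rise₁) ∷ ℕ.≤-reflexive (trans (sym I.w-rise₁) I.level) ∷ [])
      where
      module I = Below t
      module II = Below (swap-parents t)
      open TwoParents t using (u₁≢u₂)
      y≢u₁ = rise⇒≢ I.rise₁
      y≢u₂ = rise⇒≢ I.rise₂
      dy : d x y ≡ 2 + d x I.w₁
      dy = trans I.rise₁ (cong suc I.w-rise₁)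
      above : d x I.w₁ < d x y
      above = subst (d x I.w₁ <_) (sym dy) (ℕ.m<n⇒m<1+n (ℕ.n<1+n _))

    excess-no-square : n ≤ size G → 8 ≤ ∑[ y < n ] excess x y
    excess-no-square n≤m with two-parents-exist n≤m x
    ... | y , u₁ , u₂ , t = begin
      8
        ≤⟨ ℕ.+-mono-≤ (excess-child t) (ℕ.+-mono-≤ (excess-parent t) (ℕ.+-mono-≤ (excess-parent (swap-parents t))
             (ℕ.+-mono-≤ I.excess-grandparent (ℕ.+-mono-≤ II.excess-grandparent z≤n)))) ⟩
      List.sum (map (excess x) (y ∷ u₁ ∷ u₂ ∷ I.w₁ ∷ II.w₁ ∷ []))
        ≤⟨ sum-over-unique (excess x)
             ( (rise⇒≢ I.rise₁ ∷ rise⇒≢ I.rise₂ ∷ I.y≢w₁ ∷ II.y≢w₁ ∷ [])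
             ∷ (u₁≢u₂ ∷ rise⇒≢ I.w-rise₁ ∷ rise⇒≢ (trans I.level II.w-rise₁) ∷ [])
             ∷ (rise⇒≢ (trans (sym I.level) I.w-rise₁) ∷ rise⇒≢ II.w-rise₁ ∷ [])
             -- The two grandparents differ, since only the first is adjacent to `u₁`.
             ∷ ((λ eq → II.w₁≁u₂ (subst (λ w → Adj G w u₁) eq I.w₁u₁)) ∷ [])
             ∷ [] ∷ []) ⟩
      ∑[ y < n ] excess x y ∎
      where
      open ≤-Reasoning
      module I = Below t
      module II = Below (swap-parents t)
      open TwoParents t using (u₁≢u₂)

  -- Squares

  squareExcess : V → V → V → V → V → ℕ
  squareExcess a b c e x = List.sum (map (excess x) (a ∷ b ∷ c ∷ e ∷ []))

  squareExcess-rotate : ∀ a b c e x → squareExcess a b c e x ≡ squareExcess b c e a x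
  squareExcess-rotate a b c e x = lemma (excess x a) (excess x b) (excess x c) (excess x e)
    where
    lemma : ∀ i j k l → i + (j + (k + (l + 0))) ≡ j + (k + (l + (i + 0)))
    lemma = solve-∀

  record Gated (a b c e x : V) : Set where
    field
      rise-b : d x b ≡ suc (d x a)
      rise-e : d x e ≡ suc (d x a)
      rise-c : d x c ≡ suc (d x b)

    rise-c′ : d x c ≡ suc (d x e)
    rise-c′ = trans rise-c (cong suc (trans rise-b (sym rise-e)))

  mirror-gated : ∀ {a b c e x} → Gated a b c e x → Gated a e c b x
  mirror-gated g = let open Gated g in record { rise-b = rise-e ; rise-e = rise-b ; rise-c = rise-c′ }

  -- Not only `ab` but also the parallel edge `ec` separates `x` from `b`.
  gated-excess-side : ∀ {a b c e x} → Square a b c e → Gated a b c e x → 1 ≤ excess x b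
  gated-excess-side {a} {b} {c} {e} {x} s g = excess-lower 1 $ subst (λ k → 1 + k ≤ μ x b) (sym rise-b) $
    μ-lower-above {L = (a , b) ∷ (e , c) ∷ []} (d x a) (ℕ.≤-trans (ℕ.n≤1+n _) (ℕ.≤-reflexive (sym rise-b)))
      (((a≢e ∘ cong proj₁) ∷ []) ∷ [] ∷ [])
      (sep-last ab rise-b ∷ sep-last₂ (symm G ce) (symm G bc) (b≢e ∘ sym) rise-c′ ∷ [])
      ( ℕ.≤-reflexive (sym rise-b)
      ∷ subst (d x a <_) (sym (trans rise-c (cong suc rise-b))) (ℕ.m<n⇒m<1+n (ℕ.n<1+n _)) ∷ [])
    where
    open Square s
    open Gated g
    a≢e : a ≢ e
    a≢e = rise⇒≢ rise-e ∘ sym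

  -- All four edges of the square separate `x` from `c`, while a geodesic needs two on these levels.
  gated-excess-opposite : ∀ {a b c e x} → Square a b c e → Gated a b c e x → 2 ≤ excess x c
  gated-excess-opposite {a} {b} {c} {e} {x} s g = excess-lower 2 $ subst (λ k → 2 + k ≤ μ x c) (sym dc) $
    μ-lower-above {L = (a , b) ∷ (a , e) ∷ (b , c) ∷ (e , c) ∷ []} (d x a)
      (subst (d x a ≤_) (sym dc) (ℕ.m≤n⇒m≤1+n (ℕ.n≤1+n _)))
      ( ((b≢e ∘ cong proj₂) ∷ (a≢b ∘ cong proj₁) ∷ (a≢e ∘ cong proj₁) ∷ [])
      ∷ ((a≢b ∘ cong proj₁) ∷ (a≢e ∘ cong proj₁) ∷ [])
      ∷ ((b≢e ∘ cong proj₁) ∷ []) ∷ [] ∷ [])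
      ( sep-last₂ ab bc a≢c rise-b ∷ sep-last₂ (symm G ea) (symm G ce) a≢c rise-e
      ∷ sep-last bc rise-c ∷ sep-last (symm G ce) rise-c′ ∷ [])
      (ℕ.≤-reflexive (sym rise-b) ∷ ℕ.≤-reflexive (sym rise-e) ∷ above ∷ above ∷ [])
    where
    open Square s
    open Gated g
    a≢b : a ≢ b
    a≢b = rise⇒≢ rise-b ∘ sym
    a≢e : a ≢ e
    a≢e = rise⇒≢ rise-e ∘ sym
    dc : d x c ≡ 2 + d x a
    dc = trans rise-c (cong suc rise-b)
    above : d x a < d x c
    above = subst (d x a <_) (sym dc) (ℕ.m<n⇒m<1+n (ℕ.n<1+n _))

  -- The case of two nearest corners `a` and `c`: both edges at `c` lead away from `x` but towards
  -- `a`, and `b` is reached from both sides.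
  module LevelOpposite {a b c e x} (s : Square a b c e)
    (rise-b : d x b ≡ suc (d x a)) (rise-e : d x e ≡ suc (d x a)) (fall-c : d x b ≡ suc (d x c)) where

    open Square s

    level : d x a ≡ d x c
    level = ℕ.suc-injective (trans (sym rise-b) fall-c)

    excess-near : 2 ≤ excess x a
    excess-near = excess-lower 2 $ μ-lower-above {L = (c , b) ∷ (c , e) ∷ []} (d x a) ℕ.≤-refl
      (((b≢e ∘ cong proj₂) ∷ []) ∷ [] ∷ [])
      ( sep-last₂ (symm G bc) (symm G ab) (a≢c ∘ sym) fall-c
      ∷ sep-last₂ ce ea (a≢c ∘ sym) (trans rise-e (cong suc level)) ∷ [])
      (ℕ.≤-reflexive (sym rise-b) ∷ ℕ.≤-reflexive (sym rise-e) ∷ [])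

    excess-side : 1 ≤ excess x b
    excess-side = excess-lower 1 $ subst (λ k → 1 + k ≤ μ x b) (sym rise-b) $
      μ-lower-above {L = (a , b) ∷ (c , b) ∷ []} (d x a) (ℕ.≤-trans (ℕ.n≤1+n _) (ℕ.≤-reflexive (sym rise-b)))
        (((a≢c ∘ cong proj₁) ∷ []) ∷ [] ∷ [])
        (sep-last ab rise-b ∷ sep-last (symm G bc) fall-c ∷ [])
        (ℕ.≤-reflexive (sym rise-b) ∷ ℕ.≤-reflexive (sym rise-b) ∷ [])

  -- If `c` lies above `b` and `e`, then `a` is a gate and the excesses are at least 0, 1, 2, 1.
  -- Otherwise `c` is level with `a`, and 2, 1, 2 at `a`, `b`, `c` already exceed 4.
  local-minimum-excess : ∀ {a b c e x} → Square a b c e → d x b ≡ suc (d x a) → d x e ≡ suc (d x a) →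
    4 ≤ squareExcess a b c e x × (squareExcess a b c e x ≤ 4 → Gated a b c e x)
  local-minimum-excess {a} {b} {c} {e} {x} s rise-b rise-e with adj-step x (Square.bc s)
  ... | inj₁ rise-c =
    ℕ.+-mono-≤ (z≤n {excess x a}) (ℕ.+-mono-≤ (gated-excess-side s g) (ℕ.+-mono-≤ (gated-excess-opposite s g)
      (ℕ.+-mono-≤ (gated-excess-side (mirror s) (mirror-gated g)) z≤n))) , λ _ → g
    where
    g : Gated a b c e x
    g = record { rise-b = rise-b ; rise-e = rise-e ; rise-c = rise-c }
  ... | inj₂ fall-c = ℕ.<⇒≤ five , λ four → contradiction (ℕ.≤-trans five four) ℕ.1+n≰n
    where
    module L = LevelOpposite s rise-b rise-e fall-c
    rise-b′ = fall-c
    rise-e′ = trans rise-e (cong suc L.level)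
    module L′ = LevelOpposite (rotate (rotate s)) rise-e′ rise-b′ rise-e
    five : 5 ≤ squareExcess a b c e x
    five = ℕ.+-mono-≤ L.excess-near (ℕ.+-mono-≤ L.excess-side (ℕ.+-mono-≤ L′.excess-near (z≤n {excess x e + 0})))

  GatedSomewhere : V → V → V → V → V → Set
  GatedSomewhere a b c e x = Gated a b c e x ⊎ Gated b c e a x ⊎ Gated c e a b x ⊎ Gated e a b c x

  HasGate : V → V → V → V → V → Set
  HasGate a b c e x = 4 ≤ squareExcess a b c e x × (squareExcess a b c e x ≤ 4 → GatedSomewhere a b c e x)

  unrotate : ∀ {a b c e x} → HasGate b c e a x → HasGate a b c e x
  unrotate {a} {b} {c} {e} {x} (four , gate) =
    subst (4 ≤_) (sym (squareExcess-rotate a b c e x)) four ,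
    λ le → back (gate (subst (_≤ 4) (squareExcess-rotate a b c e x) le))
    where
    back : GatedSomewhere b c e a x → GatedSomewhere a b c e x
    back (inj₁ g)               = inj₂ (inj₁ g)
    back (inj₂ (inj₁ g))        = inj₂ (inj₂ (inj₁ g))
    back (inj₂ (inj₂ (inj₁ g))) = inj₂ (inj₂ (inj₂ g))
    back (inj₂ (inj₂ (inj₂ g))) = inj₁ g

  minimum-at : ∀ {a b c e x} → Square a b c e → d x b ≡ suc (d x a) → d x e ≡ suc (d x a) → HasGate a b c e x
  minimum-at s rise-b rise-e = let four , gate = local-minimum-excess s rise-b rise-e in four , inj₁ ∘ gate

  -- Distances to `x` change by exactly one along each side, so going around the square they have a
  -- local minimum, which is rotated into the first position.
  square-excess : ∀ {a b c e} → Square a b c e → ∀ x → HasGate a b c e x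
  square-excess {a} {b} {c} {e} s x
    with adj-step x (Square.ab s) | adj-step x (Square.bc s) | adj-step x (Square.ce s) | adj-step x (Square.ea s)
  ... | inj₁ a<b | _        | _        | inj₂ a<e = minimum-at s a<b a<e
  ... | inj₂ b<a | inj₁ b<c | _        | _        = unrotate (minimum-at (rotate s) b<c b<a)
  ... | _        | inj₂ c<b | inj₁ c<e | _        = unrotate (unrotate (minimum-at (rotate (rotate s)) c<e c<b))
  ... | _        | _        | inj₂ e<c | inj₁ e<a =
    unrotate (unrotate (unrotate (minimum-at (rotate (rotate (rotate s))) e<a e<c)))
  -- The distance cannot rise, or fall, all the way around.
  ... | inj₁ a<b | inj₁ b<c | inj₁ c<e | inj₁ e<a =
    contradiction (trans e<a (cong suc (trans c<e (cong suc (trans b<c (cong suc a<b)))))) (ℕ.m≢1+n+m (d x a) {3})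
  ... | inj₂ b<a | inj₂ c<b | inj₂ e<c | inj₂ a<e =
    contradiction (trans b<a (cong suc (trans c<b (cong suc (trans e<c (cong suc a<e)))))) (ℕ.m≢1+n+m (d x a) {3})

  -- The total excess relative to a square

  vertices : V → V → V → V → List V
  vertices a b c e = a ∷ b ∷ c ∷ e ∷ []

  vertices-unique : ∀ {a b c e} → Square a b c e → Unique (vertices a b c e)
  vertices-unique s =
      (adj⇒≢ ab ∷ a≢c ∷ adj⇒≢ (symm G ea) ∷ [])
    ∷ (adj⇒≢ bc ∷ b≢e ∷ []) ∷ (adj⇒≢ ce ∷ []) ∷ [] ∷ []
    where
    open Square s
    adj⇒≢ : ∀ {u v} → Adj G u v → u ≢ v
    adj⇒≢ uv refl = irrefl G uv

  module SplitExcess {a b c e} (s : Square a b c e) where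

    open Complement (complement (vertices-unique s)) public

    F : V → ℕ
    F = squareExcess a b c e

    inner : ℕ
    inner = List.sum (map F (vertices a b c e))

    cross : ℕ
    cross = sum (F ∘ ρ)

    outer : ℕ
    outer = ∑[ i < r ] ∑[ j < r ] excess (ρ i) (ρ j)

    totalExcess-split : totalExcess ≡ (inner + cross) + (cross + outer)
    totalExcess-split = begin
      ∑[ x < n ] ∑[ y < n ] excess x y
        ≡⟨ sum-cong-≗ {n} (λ x → split (excess x)) ⟩
      ∑[ x < n ] (F x + ∑[ j < r ] excess x (ρ j))
        ≡⟨ ∑-distrib-+ F _ ⟩
      sum F + ∑[ x < n ] ∑[ j < r ] excess x (ρ j)
        ≡⟨ cong₂ _+_ (split F) (∑-comm (λ x j → excess x (ρ j))) ⟩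
      (inner + cross) + ∑[ j < r ] ∑[ x < n ] excess x (ρ j)
        ≡⟨ cong ((inner + cross) +_) (sum-cong-≗ {r} (λ j →
             trans (sum-cong-≗ {n} (λ x → excess-sym x (ρ j))) (split (excess (ρ j))))) ⟩
      (inner + cross) + ∑[ j < r ] (F (ρ j) + ∑[ i < r ] excess (ρ j) (ρ i))
        ≡⟨ cong ((inner + cross) +_) (∑-distrib-+ (F ∘ ρ) _) ⟩
      (inner + cross) + (cross + outer) ∎
      where open ≡-Reasoning

    -- 16 + 8 r = 8 n - 16
    extremal : (16 + r ℕ.* 4) + (r ℕ.* 4 + 0) + 16 ≡ 8 ℕ.* n
    extremal = trans (lemma r) (cong (8 ℕ.*_) (sym n≡))
      where
      lemma : ∀ r → (16 + r ℕ.* 4) + (r ℕ.* 4 + 0) + 16 ≡ 8 ℕ.* (4 + r)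
      lemma = solve-∀

    F-lower : ∀ x → 4 ≤ F x
    F-lower x = proj₁ (square-excess s x)

    inner-lower : 16 ≤ inner
    inner-lower =
      ℕ.+-mono-≤ (F-lower a) (ℕ.+-mono-≤ (F-lower b) (ℕ.+-mono-≤ (F-lower c) (ℕ.+-mono-≤ (F-lower e) z≤n)))

    cross-lower : r ℕ.* 4 ≤ cross
    cross-lower = subst (_≤ cross) (sum-const r 4) (sum-mono (F-lower ∘ ρ))

    totalExcess-lower : 8 ℕ.* n ≤ totalExcess + 16
    totalExcess-lower = subst₂ (λ i j → i ≤ j + 16) extremal (sym totalExcess-split)
      (ℕ.+-monoˡ-≤ 16 (ℕ.+-mono-≤ (ℕ.+-mono-≤ inner-lower cross-lower) (ℕ.+-mono-≤ cross-lower z≤n)))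

    totalExcess-upper : inner ≤ 16 → cross ≤ r ℕ.* 4 → outer ≤ 0 → totalExcess + 16 ≤ 8 ℕ.* n
    totalExcess-upper i c o = subst₂ (λ i j → i + 16 ≤ j) (sym totalExcess-split) extremal
      (ℕ.+-monoˡ-≤ 16 (ℕ.+-mono-≤ (ℕ.+-mono-≤ i c) (ℕ.+-mono-≤ c o)))

    -- The lower bounds for `inner`, `cross` and `outer` use up the whole budget, so `cross` and
    -- `outer` meet theirs, and by `sum-tight` so does every summand of these two.
    module Extremal (tight : totalExcess + 16 ≤ 8 ℕ.* n) where

      budget : (inner + cross) + (cross + outer) ≤ (16 + r ℕ.* 4) + (r ℕ.* 4 + 0)
      budget = ℕ.+-cancelʳ-≤ 16 _ _ (subst₂ (λ i j → i + 16 ≤ j) totalExcess-split (sym extremal) tight)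

      cross-tight : cross ≤ r ℕ.* 4
      cross-tight = ℕ.+-cancelˡ-≤ (16 + r ℕ.* 4) _ _ $ begin
        (16 + r ℕ.* 4) + cross            ≤⟨ ℕ.+-mono-≤ (ℕ.+-mono-≤ inner-lower cross-lower) (ℕ.m≤m+n cross outer) ⟩
        (inner + cross) + (cross + outer) ≤⟨ budget ⟩
        (16 + r ℕ.* 4) + (r ℕ.* 4 + 0)    ≡⟨ cong ((16 + r ℕ.* 4) +_) (ℕ.+-identityʳ _) ⟩
        (16 + r ℕ.* 4) + r ℕ.* 4          ∎
        where open ≤-Reasoning

      outer-tight : outer ≤ 0
      outer-tight = ℕ.+-cancelˡ-≤ (r ℕ.* 4) _ _ $ ℕ.+-cancelˡ-≤ (16 + r ℕ.* 4) _ _ $ begin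
        (16 + r ℕ.* 4) + (r ℕ.* 4 + outer)
          ≤⟨ ℕ.+-mono-≤ (ℕ.+-mono-≤ inner-lower cross-lower) (ℕ.+-monoˡ-≤ outer cross-lower) ⟩
        (inner + cross) + (cross + outer)
          ≤⟨ budget ⟩
        (16 + r ℕ.* 4) + (r ℕ.* 4 + 0) ∎
        where open ≤-Reasoning

      F-tight : ∀ {x} → x ∉ vertices a b c e → F x ≤ 4
      F-tight x∉ with cover x∉
      ... | i , refl = sum-tight (F-lower ∘ ρ) (subst (cross ≤_) (sym (sum-const r 4)) cross-tight) i

      zero-row : ∀ {m} {f : Fin m → ℕ} → sum f ≤ 0 → ∀ i → f i ≤ 0
      zero-row {m} {f} le = sum-tight (λ _ → z≤n) (subst (sum f ≤_) (sym (trans (sum-const m 0) (ℕ.*-zeroʳ m))) le)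

      excess-tight : ∀ {x y} → x ∉ vertices a b c e → y ∉ vertices a b c e → excess x y ≤ 0
      excess-tight x∉ y∉ with cover x∉ | cover y∉
      ... | i , refl | j , refl = zero-row (zero-row outer-tight i) j

      gate : ∀ {x} → x ∉ vertices a b c e → GatedSomewhere a b c e x
      gate {x} x∉ = proj₂ (square-excess s x) (F-tight x∉)

      -- The corners `b`, `c`, `e` take at least 1 + 2 + 1 out of the 4 allowed, which leaves
      -- nothing for `a`.
      excess-gate : ∀ {x} → x ∉ vertices a b c e → Gated a b c e x → excess x a ≤ 0
      excess-gate {x} x∉ g = ℕ.+-cancelʳ-≤ 4 _ _ (ℕ.≤-trans
        (ℕ.+-monoʳ-≤ (excess x a) (ℕ.+-mono-≤ (gated-excess-side s g) (ℕ.+-mono-≤ (gated-excess-opposite s g)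
          (ℕ.+-mono-≤ (gated-excess-side (mirror s) (mirror-gated g)) z≤n))))
        (F-tight x∉))

  -- Two vertices with distinct gates on a square have positive excess: with no excess,
  -- all separating edges lie on one geodesic, but opposite or adjacent sides of the square do not.

  different-gates₁ : ∀ {a b c e x y} → Square a b c e → Gated a b c e x → Gated b c e a y → ¬ excess x y ≤ 0
  different-gates₁ {a} {b} {c} {e} {x} {y} s gx gy le = b≢e $
    tight-consecutive (excess-zero le) (ab , X.rise-b , Y.rise-e) (symm G ce , X.rise-c′ , Y.rise-c)
      (trans X.rise-b (sym X.rise-e))
    where
    open Square s
    module X = Gated gx
    module Y = Gated gy

  different-gates₂ : ∀ {a b c e x y} → Square a b c e → Gated a b c e x → Gated c e a b y → ¬ excess x y ≤ 0
  different-gates₂ {a} {b} {c} {e} {x} {y} s gx gy le = b≢e $ cong proj₂ $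
    tight-level-unique (excess-zero le) (ab , X.rise-b , Y.rise-c′) (symm G ea , X.rise-e , Y.rise-c)
      (trans X.rise-b (sym X.rise-e))
    where
    open Square s
    module X = Gated gx
    module Y = Gated gy

  -- 4-cycles attached at a single vertex

  record PendantSquare (a b c e : V) : Set where
    field
      square      : Square a b c e
      b-neighbour : ∀ {v} → Adj G b v → v ≡ a ⊎ v ≡ c
      c-neighbour : ∀ {v} → Adj G c v → v ≡ b ⊎ v ≡ e
      e-neighbour : ∀ {v} → Adj G e v → v ≡ c ⊎ v ≡ a

    Tail : V → Set
    Tail v = v ≢ b × v ≢ c × v ≢ e

  -- Unique parents for every root of the tail stand for acyclicity: the condition can be read off
  -- from excess, and it forbids a cycle at the vertex of the cycle farthest from a root.
  record Tailed (a b c e : V) : Set where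
    field
      pendant : PendantSquare a b c e

    open PendantSquare pendant public

    field
      parent-unique : ∀ {x y u₁ u₂} → Tail x → Tail y → Parent x u₁ y → Parent x u₂ y → u₁ ≡ u₂

  tail-cases : ∀ {a b c e v} → v ≢ b × v ≢ c × v ≢ e → v ≡ a ⊎ v ∉ vertices a b c e
  tail-cases {a} {v = v} (v≢b , v≢c , v≢e) with v Fin.≟ a
  ... | yes v≡a = inj₁ v≡a
  ... | no  v≢a = inj₂ λ
    { (here eq) → v≢a eq ; (there (here eq)) → v≢b eq ; (there (there (here eq))) → v≢c eq
    ; (there (there (there (here eq)))) → v≢e eq }

  open import Data.List.Membership.DecPropositional (Fin._≟_ {n}) using () renaming (_∈?_ to _∈ⱽ?_)

  -- With gate `a`, an outside vertex is strictly nearer to `a` than to `b` or `e`, and to `b` than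
  -- to `c`, so it is adjacent to none of `b`, `c`, `e`. Chords of the square are excluded by
  -- parity.
  all-gated⇒tailed : ∀ {a b c e} → Square a b c e → totalExcess + 16 ≤ 8 ℕ.* n →
    (∀ {x} → x ∉ vertices a b c e → Gated a b c e x) → Tailed a b c e
  all-gated⇒tailed {a} {b} {c} {e} s tight gated = record
    { pendant = record { square = s ; b-neighbour = b-nbr ; c-neighbour = c-nbr ; e-neighbour = e-nbr }
    -- The edges from two parents to `y` both separate `x` from `y` and have the same level, but
    -- zero excess allows one edge per level.
    ; parent-unique = λ {x} {y} {u₁} {u₂} tx ty p₁ p₂ → cong proj₁ (tight-level-unique
        (no-excess tx ty p₁) (sep-last (proj₁ p₁) (proj₂ p₁)) (sep-last (proj₁ p₂) (proj₂ p₂)) refl)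
    }
    where
    open Square s
    open SplitExcess s
    open Extremal tight
    not-adjacent : ∀ {u v w} → d v u ≡ suc (d v w) → v ≢ w → ¬ Adj G u v
    not-adjacent {u} {v} {w} rise v≢w uv =
      v≢w (d≡0⇒≡ (sym (ℕ.suc-injective (trans (sym (d-one (symm G uv))) rise))))
    b-nbr : ∀ {v} → Adj G b v → v ≡ a ⊎ v ≡ c
    b-nbr {v} bv with v ∈ⱽ? vertices a b c e
    ... | yes (here eq)                         = inj₁ eq
    ... | yes (there (here refl))               = contradiction bv (irrefl G)
    ... | yes (there (there (here eq)))         = inj₂ eq
    ... | yes (there (there (there (here refl)))) =
      contradiction (trans (d-one ab) (sym (d-one (symm G ea)))) (adj-≢ a bv)
    ... | no v∉ = contradiction bv (not-adjacent (Gated.rise-b (gated v∉)) (v∉ ∘ here))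
    e-nbr : ∀ {v} → Adj G e v → v ≡ c ⊎ v ≡ a
    e-nbr {v} ev with v ∈ⱽ? vertices a b c e
    ... | yes (here eq)                         = inj₂ eq
    ... | yes (there (here refl)) =
      contradiction (trans (d-one (symm G ea)) (sym (d-one ab))) (adj-≢ a ev)
    ... | yes (there (there (here eq)))         = inj₁ eq
    ... | yes (there (there (there (here refl)))) = contradiction ev (irrefl G)
    ... | no v∉ = contradiction ev (not-adjacent (Gated.rise-e (gated v∉)) (v∉ ∘ here))
    c-nbr : ∀ {v} → Adj G c v → v ≡ b ⊎ v ≡ e
    c-nbr {v} cv with v ∈ⱽ? vertices a b c e
    ... | yes (here refl) =
      contradiction (trans (d-one bc) (sym (d-one (symm G ab)))) (adj-≢ b cv)
    ... | yes (there (here eq))                 = inj₁ eq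
    ... | yes (there (there (here refl)))       = contradiction cv (irrefl G)
    ... | yes (there (there (there (here eq)))) = inj₂ eq
    ... | no v∉ = contradiction cv (not-adjacent (Gated.rise-c (gated v∉)) (v∉ ∘ there ∘ here))
    no-excess : ∀ {x y u} → x ≢ b × x ≢ c × x ≢ e → y ≢ b × y ≢ c × y ≢ e → Parent x u y → μ x y ≤ d x y
    no-excess {x} {y} tx ty (_ , rise) with tail-cases {a} tx | tail-cases {a} ty
    ... | inj₁ refl | inj₁ refl = contradiction (trans (sym (d-refl x)) rise) ℕ.0≢1+n
    ... | inj₁ refl | inj₂ y∉   = excess-zero (subst (_≤ 0) (excess-sym y x) (excess-gate y∉ (gated y∉)))
    ... | inj₂ x∉   | inj₁ refl = excess-zero (excess-gate x∉ (gated x∉))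
    ... | inj₂ x∉   | inj₂ y∉   = excess-zero (excess-tight x∉ y∉)

  ∉-rotate : ∀ {a b c e v} → v ∉ vertices a b c e → v ∉ vertices b c e a
  ∉-rotate v∉ (here eq)                         = v∉ (there (here eq))
  ∉-rotate v∉ (there (here eq))                 = v∉ (there (there (here eq)))
  ∉-rotate v∉ (there (there (here eq)))         = v∉ (there (there (there (here eq))))
  ∉-rotate v∉ (there (there (there (here eq)))) = v∉ (here eq)

  -- Any other outside vertex has zero excess with `v` and hence cannot have a different gate.
  one-gate⇒tailed : ∀ {a b c e v} → Square a b c e → totalExcess + 16 ≤ 8 ℕ.* n →
    v ∉ vertices a b c e → Gated a b c e v → Tailed a b c e
  one-gate⇒tailed {a} {b} {c} {e} {v} s tight v∉ gv = all-gated⇒tailed s tight gated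
    where
    open SplitExcess s
    open Extremal tight
    gated : ∀ {x} → x ∉ vertices a b c e → Gated a b c e x
    gated {x} x∉ with gate x∉
    ... | inj₁ g               = g
    ... | inj₂ (inj₁ g)        = contradiction (excess-tight v∉ x∉) (different-gates₁ s gv g)
    ... | inj₂ (inj₂ (inj₁ g)) = contradiction (excess-tight v∉ x∉) (different-gates₂ s gv g)
    -- Reflection in the axis through `a` and `c` turns gate `e` into gate `b`.
    ... | inj₂ (inj₂ (inj₂ g)) = contradiction (excess-tight v∉ x∉)
      (different-gates₁ (mirror s) (mirror-gated gv) (mirror-gated g))

  extremal⇒tailed : ∀ {a b c e} → Square a b c e → totalExcess + 16 ≤ 8 ℕ.* n →
    ∃ λ a → ∃ λ b → ∃ λ c → ∃ λ e → Tailed a b c e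
  extremal⇒tailed {a} {b} {c} {e} s tight with Fin.any? (λ v → ¬? (v ∈ⱽ? vertices a b c e))
  ... | no none = _ , _ , _ , _ , all-gated⇒tailed s tight (λ x∉ → contradiction (_ , x∉) none)
  ... | yes (v , v∉) with SplitExcess.Extremal.gate s tight v∉
  ...   | inj₁ g               = _ , _ , _ , _ , one-gate⇒tailed s tight v∉ g
  ...   | inj₂ (inj₁ g)        = _ , _ , _ , _ , one-gate⇒tailed (rotate s) tight (∉-rotate v∉) g
  ...   | inj₂ (inj₂ (inj₁ g)) = _ , _ , _ , _ , one-gate⇒tailed (rotate (rotate s)) tight (∉-rotate (∉-rotate v∉)) g
  ...   | inj₂ (inj₂ (inj₂ g)) =
    _ , _ , _ , _ , one-gate⇒tailed (rotate (rotate (rotate s))) tight (∉-rotate (∉-rotate (∉-rotate v∉))) g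

  mirror-tailed : ∀ {a b c e} → Tailed a b c e → Tailed a e c b
  mirror-tailed t = record
    { pendant = record
      { square      = mirror square
      ; b-neighbour = swap ∘ e-neighbour
      ; c-neighbour = swap ∘ c-neighbour
      ; e-neighbour = swap ∘ b-neighbour
      }
    ; parent-unique = λ (x≢e , x≢c , x≢b) (y≢e , y≢c , y≢b) → parent-unique (x≢b , x≢c , x≢e) (y≢b , y≢c , y≢e)
    }
    where open Tailed t

  data SquareEdge (a b c e : V) : V → V → Set where
    ab : SquareEdge a b c e a b
    ba : SquareEdge a b c e b a
    bc : SquareEdge a b c e b c
    cb : SquareEdge a b c e c b
    ce : SquareEdge a b c e c e
    ec : SquareEdge a b c e e c
    ea : SquareEdge a b c e e a
    ae : SquareEdge a b c e a e

  module PendantGeometry {a b c e} (pendant : PendantSquare a b c e) where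

    open PendantSquare pendant
    open Square square using (a≢c; b≢e)
    module Sq = Square square

    a-tail : Tail a
    a-tail = (λ { refl → irrefl G Sq.ab }) , a≢c , (λ { refl → irrefl G Sq.ea })

    b-edge : ∀ {v} → Adj G b v → SquareEdge a b c e b v
    b-edge bv with b-neighbour bv
    ... | inj₁ refl = ba
    ... | inj₂ refl = bc

    c-edge : ∀ {v} → Adj G c v → SquareEdge a b c e c v
    c-edge cv with c-neighbour cv
    ... | inj₁ refl = cb
    ... | inj₂ refl = ce

    e-edge : ∀ {v} → Adj G e v → SquareEdge a b c e e v
    e-edge ev with e-neighbour ev
    ... | inj₁ refl = ec
    ... | inj₂ refl = ea

    reverse-edge : ∀ {u v} → SquareEdge a b c e u v → SquareEdge a b c e v u
    reverse-edge ab = ba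
    reverse-edge ba = ab
    reverse-edge bc = cb
    reverse-edge cb = bc
    reverse-edge ce = ec
    reverse-edge ec = ce
    reverse-edge ea = ae
    reverse-edge ae = ea

    edge-from : ∀ {u v} → Adj G u v → Tail u ⊎ SquareEdge a b c e u v
    edge-from {u} uv with u Fin.≟ b | u Fin.≟ c | u Fin.≟ e
    ... | yes refl | _        | _        = inj₂ (b-edge uv)
    ... | no _     | yes refl | _        = inj₂ (c-edge uv)
    ... | no _     | no _     | yes refl = inj₂ (e-edge uv)
    ... | no u≢b   | no u≢c   | no u≢e   = inj₁ (u≢b , u≢c , u≢e)

    edge-cases : ∀ {u v} → Adj G u v → (Tail u × Tail v) ⊎ SquareEdge a b c e u v
    edge-cases uv with edge-from uv | edge-from (symm G uv)
    ... | inj₂ s  | _       = inj₂ s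
    ... | inj₁ _  | inj₂ s  = inj₂ (reverse-edge s)
    ... | inj₁ tu | inj₁ tv = inj₁ (tu , tv)

    module _ {x : V} (tx : Tail x) where

      -- A walk from `b`, `c` or `e` can leave these three vertices only through `a`; the bounds are
      -- proved together by induction on the walk.
      from-b : (p : Walk G b x) → suc (d a x) ≤ walkLength p
      from-c : (p : Walk G c x) → suc (suc (d a x)) ≤ walkLength p
      from-e : (p : Walk G e x) → suc (d a x) ≤ walkLength p

      from-b ε = contradiction refl (proj₁ tx)
      from-b (bv ◅ p) with b-neighbour bv
      ... | inj₁ refl = s≤s (d-minimal p)
      ... | inj₂ refl = ℕ.≤-trans (ℕ.n≤1+n _) (ℕ.≤-trans (from-c p) (ℕ.n≤1+n _))

      from-c ε = contradiction refl (proj₁ (proj₂ tx))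
      from-c (cv ◅ p) with c-neighbour cv
      ... | inj₁ refl = s≤s (from-b p)
      ... | inj₂ refl = s≤s (from-e p)

      from-e ε = contradiction refl (proj₂ (proj₂ tx))
      from-e (ev ◅ p) with e-neighbour ev
      ... | inj₁ refl = ℕ.≤-trans (ℕ.n≤1+n _) (ℕ.≤-trans (from-c p) (ℕ.n≤1+n _))
      ... | inj₂ refl = s≤s (d-minimal p)

      far : ∀ {v} k → (∀ (p : Walk G v x) → k + d a x ≤ walkLength p) → k + d x a ≤ d x v
      far {v} k bound with geodesic v x
      ... | p , eq = subst₂ _≤_ (cong (k +_) (d-sym a x)) (trans eq (d-sym v x)) (bound p)

      tail-gated : Gated a b c e x
      tail-gated = record
        { rise-b = rise-b
        ; rise-e = ℕ.≤-antisym (d-adj x (symm G Sq.ea)) (far 1 from-e)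
        ; rise-c = ℕ.≤-antisym (d-adj x Sq.bc) (subst (λ k → suc k ≤ d x c) (sym rise-b) (far 2 from-c))
        }
        where
        rise-b : d x b ≡ suc (d x a)
        rise-b = ℕ.≤-antisym (d-adj x Sq.ab) (far 1 from-b)

    -- Only `b` and `e` could lead from outside into the tail, namely to `a`, but seen from the tail
    -- they lie above `a`.
    parent-tail : ∀ {x y u} → Tail x → Tail y → Parent x u y → Tail u
    parent-tail {x} {y} tx ty (uy , rise) with edge-cases uy
    ... | inj₁ (tu , _) = tu
    ... | inj₂ s        = contradiction rise (by-edge s ty)
      where
      module X = Gated (tail-gated tx)
      by-edge : ∀ {p q} → SquareEdge a b c e p q → Tail q → d x q ≢ suc (d x p)
      by-edge ab (q≢b , _)     _ = q≢b refl
      by-edge ba _ up            = rise-asym X.rise-b up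
      by-edge bc (_ , q≢c , _) _ = q≢c refl
      by-edge cb (q≢b , _)     _ = q≢b refl
      by-edge ce (_ , _ , q≢e) _ = q≢e refl
      by-edge ec (_ , q≢c , _) _ = q≢c refl
      by-edge ea _ up            = rise-asym X.rise-e up
      by-edge ae (_ , _ , q≢e) _ = q≢e refl

    par-tail : ∀ {x y} → Tail x → Tail y → Tail (par x y)
    par-tail {x} {y} tx ty with d x y ℕ.≟ 0
    ... | yes zero-y = subst Tail (d≡0⇒≡ (trans (d-par x y) (cong pred zero-y))) tx
    ... | no  y-pos  = parent-tail tx ty (par-adj (ℕ.n≢0⇒n>0 y-pos) , par-rise (ℕ.n≢0⇒n>0 y-pos))

    anc-tail : ∀ {x v} → Tail x → Tail v → ∀ i → Tail (anc x v i)
    anc-tail tx tv zero    = tv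
    anc-tail tx tv (suc i) = par-tail tx (anc-tail tx tv i)

  -- Upper bounds on the excess

  module TailedExcess {a b c e} (t : Tailed a b c e) where

    open Tailed t
    open Square square using (a≢c; b≢e)
    open PendantGeometry pendant

    separator-bound : ∀ {x y} es → (∀ {p q} → Sep x y (p , q) → (p , q) ∈ es) → μ x y ≤ length es
    separator-bound {x} {y} es sub = length-mono-⊆ {ys = es} (separators-unique x y)
      (λ f∈ → sub (proj₂ (∈-filter⁻ (sep? x y) {xs = cartesianProduct (allFin n) (allFin n)} f∈)))

    μ-diag : ∀ x → μ x x ≤ 0
    μ-diag x = separator-bound [] λ (_ , up , down) → contradiction down (rise-asym up)

    -- All of the tail has the gate `a` and therefore sees the square edges from the same side.
    tail-square-edge : ∀ {x y p q} → Tail x → Tail y → SquareEdge a b c e p q → ¬ Sep x y (p , q)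
    tail-square-edge {x} {y} tx ty s (_ , up , down) = by-edge s up down
      where
      module X = Gated (tail-gated tx)
      module Y = Gated (tail-gated ty)
      by-edge : ∀ {p q} → SquareEdge a b c e p q → d x q ≡ suc (d x p) → d y p ≢ suc (d y q)
      by-edge ab _  down = rise-asym Y.rise-b down
      by-edge ba up _    = rise-asym X.rise-b up
      by-edge bc _  down = rise-asym Y.rise-c down
      by-edge cb up _    = rise-asym X.rise-c up
      by-edge ce up _    = rise-asym X.rise-c′ up
      by-edge ec _  down = rise-asym Y.rise-c′ down
      by-edge ea up _    = rise-asym X.rise-e up
      by-edge ae _  down = rise-asym Y.rise-e down

    -- If pq separates x from a neighbour y and p ≠ x, then q has a second parent, on a geodesic from x through y.
    tail-edge-separators : ∀ {x y p q} → Tail x → Tail y → Adj G x y → Sep x y (p , q) → (p , q) ≡ (x , y)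
    tail-edge-separators {x} {y} {p} {q} tx ty xy (pq , up , down) with edge-cases pq
    ... | inj₂ s = contradiction (pq , up , down) (tail-square-edge tx ty s)
    ... | inj₁ (tp , tq) with d y q ℕ.≟ 0
    ...   | yes zero-q = cong₂ _,_ (sym (d≡0⇒≡ x-p)) (sym (d≡0⇒≡ zero-q))
      where
      x-p : d x p ≡ 0
      x-p = ℕ.suc-injective (trans (sym up) (trans (cong (d x) (sym (d≡0⇒≡ zero-q))) (d-one xy)))
    ...   | no nonzero-q = contradiction same
      (λ eq → rise-asym (trans (par-rise 0<q) (cong suc (cong (d y) (sym eq)))) down)
      where
      0<q = ℕ.n≢0⇒n>0 nonzero-q
      p′ = par y q
      near : ∀ w → d x w ≤ suc (d y w)
      near w = subst₂ (λ i j → i ≤ suc j) (d-sym w x) (d-sym w y) (d-adj w (symm G xy))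
      near′ : ∀ w → d y w ≤ suc (d x w)
      near′ w = subst₂ (λ i j → i ≤ suc j) (d-sym w y) (d-sym w x) (d-adj w xy)
      x-q : d x q ≡ suc (d y q)
      x-q = ℕ.≤-antisym (near q) (subst₂ _≤_ down (sym up) (near′ p))
      rise′ : d x q ≡ suc (d x p′)
      rise′ with adj-step x (par-adj 0<q)
      ... | inj₁ eq = eq
      ... | inj₂ eq = contradiction (subst₂ _≤_ eq (sym (par-rise 0<q)) (near p′))
        (ℕ.<⇒≱ (s≤s (ℕ.≤-trans (ℕ.n≤1+n _) (ℕ.≤-reflexive (sym x-q)))))
      same : p ≡ p′
      same = parent-unique tx tq (pq , up) (par-adj 0<q , rise′)

    μ-tail-edge : ∀ {x y} → Tail x → Tail y → Adj G x y → μ x y ≤ 1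
    μ-tail-edge {x} {y} tx ty xy = separator-bound ((x , y) ∷ []) (here ∘ tail-edge-separators tx ty xy)

    -- Along a geodesic inside the tail each edge costs one by `μ-tail-edge`, and `μ-triangle` adds
    -- up the costs.
    μ-tail : ∀ {x} → Tail x → ∀ k {y} → Tail y → d x y ≡ k → μ x y ≤ k
    μ-tail {x} tx zero    ty eq with refl ← d≡0⇒≡ eq = μ-diag x
    μ-tail {x} tx (suc k) {y} ty eq = begin
      μ x y                     ≤⟨ μ-triangle x (par x y) y ⟩
      μ x (par x y) + μ (par x y) y
        ≤⟨ ℕ.+-mono-≤ (μ-tail tx k tp (ℕ.suc-injective (trans (sym (par-rise 0<d)) eq)))
             (μ-tail-edge tp ty (par-adj 0<d)) ⟩
      k + 1                     ≡⟨ ℕ.+-comm k 1 ⟩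
      suc k                     ∎
      where
      open ≤-Reasoning
      0<d : 0 < d x y
      0<d = subst (0 <_) (sym eq) (s≤s z≤n)
      tp = par-tail tx ty

    excess-tail : ∀ {x y} → Tail x → Tail y → excess x y ≤ 0
    excess-tail {x} {y} tx ty = excess-upper 0 (subst (μ x y ≤_) (sym (ℕ.+-identityʳ _)) (μ-tail tx _ ty refl))

    d-ac : d a c ≡ 2
    d-ac = d-two Sq.ab Sq.bc a≢c

    d-be : d b e ≡ 2
    d-be = d-two Sq.bc Sq.ce b≢e

    no-rise-0 : ∀ {x w k} → x ≡ w → d x w ≢ suc k
    no-rise-0 {x} refl eq = ℕ.0≢1+n (trans (sym (d-refl x)) eq)

    -- If the distances to `u` and to `w` differ by a constant on the tail, they rise and fall
    -- together along its edges.
    shifted-separator : ∀ {u w p q} → (∀ {v} → Tail v → d w v ≡ suc (d u v)) → Tail p → Tail q → ¬ Sep u w (p , q)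
    shifted-separator shift tp tq (_ , up , down) =
      rise-asym down (trans (shift tq) (cong suc (trans up (sym (shift tp)))))

    -- Only `ab` and its parallel `ec` separate `a` from `b`, because every tail vertex is exactly
    -- one step nearer to `a`.
    μ-ab : μ a b ≤ 2
    μ-ab = separator-bound ((a , b) ∷ (e , c) ∷ []) (λ (pq , up , down) → cases pq up down)
      where
      by-edge : ∀ {p q} → SquareEdge a b c e p q → d a q ≡ suc (d a p) → d b p ≡ suc (d b q) →
        (p , q) ∈ (a , b) ∷ (e , c) ∷ []
      by-edge ab _  _    = here refl
      by-edge ec _  _    = there (here refl)
      by-edge ba up _    = contradiction up (no-rise-0 refl)
      by-edge bc _  down = contradiction down (no-rise-0 refl)
      by-edge cb up _    = contradiction up (rise-asym (trans d-ac (cong suc (sym (d-one Sq.ab)))))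
      by-edge ce up _    = contradiction up (rise-asym (trans d-ac (cong suc (sym (d-one (symm G Sq.ea))))))
      by-edge ea up _    = contradiction up (no-rise-0 refl)
      by-edge ae _  down = contradiction down (rise-asym (trans d-be (cong suc (sym (d-one (symm G Sq.ab))))))
      cases : ∀ {p q} → Adj G p q → d a q ≡ suc (d a p) → d b p ≡ suc (d b q) → (p , q) ∈ (a , b) ∷ (e , c) ∷ []
      cases {p} {q} pq up down with edge-cases pq
      ... | inj₂ s         = by-edge s up down
      ... | inj₁ (tp , tq) = contradiction (pq , up , down) (shifted-separator shift tp tq)
        where
        shift : ∀ {v} → Tail v → d b v ≡ suc (d a v)
        shift {v} tv = trans (d-sym b v) (trans (Gated.rise-b (tail-gated tv)) (cong suc (d-sym v a)))

    μ-bc : μ b c ≤ 2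
    μ-bc = separator-bound ((b , c) ∷ (a , e) ∷ []) (λ (pq , up , down) → cases pq up down)
      where
      by-edge : ∀ {p q} → SquareEdge a b c e p q → d b q ≡ suc (d b p) → d c p ≡ suc (d c q) →
        (p , q) ∈ (b , c) ∷ (a , e) ∷ []
      by-edge bc _  _    = here refl
      by-edge ae _  _    = there (here refl)
      by-edge ab up _    = contradiction up (no-rise-0 refl)
      by-edge ba _  down = contradiction down
        (rise-asym (trans (trans (d-sym c a) d-ac) (cong suc (sym (d-one (symm G Sq.bc))))))
      by-edge cb up _    = contradiction up (no-rise-0 refl)
      by-edge ce _  down = contradiction down (no-rise-0 refl)
      by-edge ec up _    = contradiction up (rise-asym (trans d-be (cong suc (sym (d-one Sq.bc)))))
      by-edge ea up _    = contradiction up (rise-asym (trans d-be (cong suc (sym (d-one (symm G Sq.ab))))))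
      cases : ∀ {p q} → Adj G p q → d b q ≡ suc (d b p) → d c p ≡ suc (d c q) → (p , q) ∈ (b , c) ∷ (a , e) ∷ []
      cases {p} {q} pq up down with edge-cases pq
      ... | inj₂ s         = by-edge s up down
      ... | inj₁ (tp , tq) = contradiction (pq , up , down) (shifted-separator shift tp tq)
        where
        shift : ∀ {v} → Tail v → d c v ≡ suc (d b v)
        shift {v} tv = trans (d-sym c v) (trans (Gated.rise-c (tail-gated tv)) (cong suc (d-sym v b)))

    -- Bounds on `μ` add up through `z`; the distance is subtracted only at the end.
    excess-via : ∀ {x y i j k} z → d x y + k ≡ i + j → μ x z ≤ i → μ z y ≤ j → excess x y ≤ k
    excess-via {x} {y} z eq p q =
      excess-upper _ (ℕ.≤-trans (μ-triangle x z y) (ℕ.≤-trans (ℕ.+-mono-≤ p q) (ℕ.≤-reflexive (sym eq))))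

    module _ {x : V} (tx : Tail x) where

      open Gated (tail-gated tx)

      excess-tail-b : excess x b ≤ 1
      excess-tail-b = excess-via {i = d x a} {2} a (trans (cong (_+ 1) rise-b) (lemma (d x a)))
        (μ-tail tx _ a-tail refl) μ-ab
        where
        lemma : ∀ k → suc k + 1 ≡ k + 2
        lemma = solve-∀

      excess-tail-c : excess x c ≤ 2
      excess-tail-c = excess-via {i = d x b + 1} {2} b (trans (cong (_+ 2) rise-c) (lemma (d x b)))
        (subst (_≤ d x b + 1) (d+excess x b) (ℕ.+-monoʳ-≤ (d x b) excess-tail-b)) μ-bc
        where
        lemma : ∀ k → suc k + 2 ≡ k + 1 + 2
        lemma = solve-∀

    excess-bc : excess b c ≤ 1
    excess-bc = excess-upper 1 (subst (λ k → μ b c ≤ k + 1) (sym (d-one Sq.bc)) μ-bc)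

    excess-diag : ∀ x → excess x x ≤ 0
    excess-diag x = ℕ.≤-trans (ℕ.m∸n≤m (μ x x) (d x x)) (μ-diag x)

  -- Every row meets the lower bound 4 on the square: 0, 1, 2, 1 from a tail vertex, and 1, 0, 1, 2
  -- or 2, 1, 0, 1 or 1, 2, 1, 0 from `b`, `c`, `e`. The entries at `e` come by reflection from
  -- those at `b`.
  tailed⇒extremal : ∀ {a b c e} → Tailed a b c e → totalExcess + 16 ≤ 8 ℕ.* n
  tailed⇒extremal {a} {b} {c} {e} t = totalExcess-upper
    (ℕ.+-mono-≤ (F-tail I.a-tail) (ℕ.+-mono-≤ F-b (ℕ.+-mono-≤ F-c (ℕ.+-mono-≤ F-e z≤n))))
    (subst (cross ≤_) (sum-const r 4) (sum-mono (λ i → F-tail (ρ-tail i))))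
    (ℕ.≤-trans (sum-mono {r} (λ i → sum-mono {r} (λ j → excess-tail (ρ-tail i) (ρ-tail j))))
      (ℕ.≤-reflexive (trans (sum-cong-≗ {r} (λ _ → zero-sum)) zero-sum)))
    where
    open Tailed t
    open SplitExcess square
    open TailedExcess t
    module I = PendantGeometry pendant
    module M = TailedExcess (mirror-tailed t)
    zero-sum : ∑[ _ < r ] 0 ≡ 0
    zero-sum = trans (sum-const r 0) (ℕ.*-zeroʳ r)
    flip-excess : ∀ {x y k} → excess x y ≤ k → excess y x ≤ k
    flip-excess {x} {y} {k} = subst (_≤ k) (excess-sym x y)
    ρ-tail : ∀ i → Tail (ρ i)
    ρ-tail i = avoid i ∘ there ∘ here , avoid i ∘ there ∘ there ∘ here , avoid i ∘ there ∘ there ∘ there ∘ here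
    e-tail : ∀ {x} → Tail x → excess x e ≤ 1
    e-tail (x≢b , x≢c , x≢e) = M.excess-tail-b (x≢e , x≢c , x≢b)
    excess-be : excess b e ≤ 2
    excess-be = excess-via a (cong (_+ 2) d-be) (subst (_≤ 2) (μ-sym a b) μ-ab) M.μ-ab
    F-tail : ∀ {x} → Tail x → F x ≤ 4
    F-tail tx = ℕ.+-mono-≤ (excess-tail tx I.a-tail)
      (ℕ.+-mono-≤ (excess-tail-b tx) (ℕ.+-mono-≤ (excess-tail-c tx) (ℕ.+-mono-≤ (e-tail tx) z≤n)))
    F-b : F b ≤ 4
    F-b = ℕ.+-mono-≤ (flip-excess (excess-tail-b I.a-tail))
      (ℕ.+-mono-≤ (excess-diag b) (ℕ.+-mono-≤ excess-bc (ℕ.+-mono-≤ excess-be z≤n)))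
    F-c : F c ≤ 4
    F-c = ℕ.+-mono-≤ (flip-excess (excess-tail-c I.a-tail))
      (ℕ.+-mono-≤ (flip-excess excess-bc) (ℕ.+-mono-≤ (excess-diag c) (ℕ.+-mono-≤ (flip-excess M.excess-bc) z≤n)))
    F-e : F e ≤ 4
    F-e = ℕ.+-mono-≤ (flip-excess (e-tail I.a-tail))
      (ℕ.+-mono-≤ (flip-excess excess-be) (ℕ.+-mono-≤ M.excess-bc (ℕ.+-mono-≤ (excess-diag e) z≤n)))

  -- Unions of a 4-cycle and a tree

  module UnionGeometry {m} {T : Graph m} (acyclic : ¬ CycleIn T) (U : UnionSharingVertex G C₄ T) where

    open UnionSharingVertex U

    φ = Injection.to f
    γ = Injection.to g

    i₀ : Fin 4
    i₀ = proj₁ (proj₁ (proj₁ (proj₂ shared-vertex)))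

    a = φ i₀
    b = φ (turn i₀)
    c = φ (turn (turn i₀))
    e = φ (turn (turn (turn i₀)))

    a∈T : VertexOf g a
    a∈T with shared-vertex
    ... | _ , ((_ , refl) , a∈γ) , _ = a∈γ

    shared-corner : ∀ {j} → VertexOf g (φ j) → j ≡ i₀
    shared-corner {j} v∈γ with shared-vertex
    ... | _ , ((_ , refl) , _) , unique = Injection.injective f (sym (unique ((j , refl) , v∈γ)))

    corner-adj : ∀ {i j} → Adj C₄ i j → Adj G (φ i) (φ j)
    corner-adj ij = Equivalence.from (edge-union _ _) (inj₁ (_ , _ , ij , refl , refl))

    square : Square a b c e
    square = record
      { ab = corner-adj (turn-adj _)
      ; bc = corner-adj (turn-adj _)
      ; ce = corner-adj (turn-adj _)
      ; ea = subst (Adj G e ∘ φ) (turn⁴ i₀) (corner-adj (turn-adj _))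
      ; a≢c = turn²-≢ i₀ ∘ sym ∘ Injection.injective f
      ; b≢e = turn²-≢ (turn i₀) ∘ sym ∘ Injection.injective f
      }

    corner-neighbour : ∀ {j v} → j ≢ i₀ → Adj G (φ j) v → v ≡ φ (turn j) ⊎ v ≡ φ (turn (turn (turn j)))
    corner-neighbour {j} {v} j≢i₀ jv with Equivalence.to (edge-union _ _) jv
    ... | inj₂ (s , _ , _ , γs≡φj , _) = contradiction (shared-corner (s , γs≡φj)) j≢i₀
    ... | inj₁ (i , k , ik , φi≡φj , refl) with refl ← Injection.injective f φi≡φj with turn-neighbour i k ik
    ...   | inj₁ refl = inj₁ refl
    ...   | inj₂ refl = inj₂ refl

    pendant : PendantSquare a b c e
    pendant = record
      { square      = square
      ; b-neighbour = λ bv → [ inj₂ , (λ eq → inj₁ (trans eq (cong φ (turn⁴ i₀)))) ]′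
          (corner-neighbour (turn-≢ i₀) bv)
      ; c-neighbour = λ cv → [ inj₂ , (λ eq → inj₁ (trans eq (cong φ (turn⁴ (turn i₀))))) ]′
          (corner-neighbour (turn²-≢ i₀) cv)
      ; e-neighbour = λ ev → [ (λ eq → inj₂ (trans eq (cong φ (turn⁴ i₀))))
                             , (λ eq → inj₁ (trans eq (cong φ (turn⁴ (turn (turn i₀)))))) ]′
          (corner-neighbour (turn³-≢ i₀) ev)
      }

    open PendantSquare pendant using (Tail)
    open PendantGeometry pendant

    tail-vertex : ∀ {v} → Tail v → VertexOf g v
    tail-vertex {v} (v≢b , v≢c , v≢e) with vertex-union v
    ... | inj₂ v∈γ = v∈γ
    ... | inj₁ (j , refl) with turn-cases i₀ j
    ...   | inj₁ refl               = a∈T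
    ...   | inj₂ (inj₁ refl)        = contradiction refl v≢b
    ...   | inj₂ (inj₂ (inj₁ refl)) = contradiction refl v≢c
    ...   | inj₂ (inj₂ (inj₂ refl)) = contradiction refl v≢e

    -- An edge of `C₄` with both ends in the tree would have both ends at the shared corner.
    tail-adj : ∀ {s t u v} → γ s ≡ u → γ t ≡ v → Adj G u v → Adj T s t
    tail-adj {s} {t} refl refl uv with Equivalence.to (edge-union _ _) uv
    ... | inj₁ (i , j , ij , φi≡ , φj≡)
      with refl ← shared-corner (s , sym φi≡) | refl ← shared-corner (t , sym φj≡) = contradiction ij (irrefl C₄)
    ... | inj₂ (s′ , t′ , st , γs≡ , γt≡)
      with refl ← Injection.injective g γs≡ | refl ← Injection.injective g γt≡ = st

    -- Descend from y through both parents; the two geodesics close up at x.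
    two-parents⇒cycle : ∀ {x y u₁ u₂} → Tail x → Tail y → TwoParents x y u₁ u₂ → CycleIn T
    two-parents⇒cycle {x} {y} {u₁} {u₂} tx ty t =
      closed-walk⇒cycle T (proj₁ ∘ lift) K
        (λ m m<K → tail-adj (lift-eq m) (lift-eq (suc m)) (walk-step m m<K))
        (λ m m<K eq → walk-no-return m m<K (trans (sym (lift-eq m)) (trans (cong γ eq) (lift-eq (2 + m)))))
        {0} {K} (s≤s z≤n) ℕ.≤-refl
        (Injection.injective g (trans (lift-eq 0) (trans closed (sym (lift-eq K)))))
      where
      open TwoParents t
      k = d x u₁
      level : d x u₁ ≡ d x u₂
      level = ℕ.suc-injective (trans (sym (proj₂ parent₁)) (proj₂ parent₂))
      -- The closed walk rises from `x` through `u₁` to `y` in `k + 1` steps and descends through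
      -- `u₂` in as many. It turns only at `y`, where the parents differ; elsewhere levels two steps
      -- apart are distinct.
      K = suc k + suc k
      R : ℕ → V
      R zero    = y
      R (suc m) = anc x u₂ m
      walk : ℕ → V
      walk = prepend (suc k) (anc x u₁) R
      R-tail : ∀ m → Tail (R m)
      R-tail zero    = ty
      R-tail (suc m) = anc-tail tx (parent-tail tx ty parent₂) m
      walk-tail : ∀ m → Tail (walk m)
      walk-tail = prepend-all {S = Tail} (anc-tail tx (parent-tail tx ty parent₁)) R-tail (suc k)
      lift : ∀ m → VertexOf g (walk m)
      lift m = tail-vertex (walk-tail m)
      lift-eq : ∀ m → γ (proj₁ (lift m)) ≡ walk m
      lift-eq m = proj₂ (lift m)
      R-step : ∀ m → m < suc k → Adj G (R m) (R (suc m))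
      R-step zero    _  = symm G (proj₁ parent₂)
      R-step (suc m) m< = symm G (par-adj (anc-pos (subst (m <_) level (ℕ.s≤s⁻¹ m<))))
      walk-step : ∀ m → m < K → Adj G (walk m) (walk (suc m))
      walk-step = prepend-step {Q = Adj G} (suc k) (suc k)
        (λ i i< → par-adj (anc-pos (ℕ.s≤s⁻¹ i<))) (proj₁ parent₁) R-step
      anc-no-return : ∀ {v i} → 2 + i ≤ d x v → anc x v (2 + i) ≢ anc x v i
      anc-no-return i< = rise₂⇒≢ (par-rise (anc-pos i<)) (par-rise (anc-pos (ℕ.<⇒≤ i<))) ∘ sym
      first-no-return : ∀ {u} → Parent x u y → 0 < d x u → par x u ≢ y
      first-no-return p 0<u = rise₂⇒≢ (par-rise 0<u) (proj₂ p) ∘ sym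
      R-no-return : ∀ m → 2 + m ≤ suc k → R m ≢ R (2 + m)
      R-no-return zero    m< = first-no-return parent₂ (subst (0 <_) level (ℕ.s≤s⁻¹ m<)) ∘ sym
      R-no-return (suc m) m< = anc-no-return (subst (2 + m ≤_) level (ℕ.s≤s⁻¹ m<)) ∘ sym
      walk-no-return : ∀ m → 2 + m ≤ K → walk m ≢ walk (2 + m)
      walk-no-return = prepend-step₂ {Q = _≢_} (suc k) (suc k)
        (λ i i< → anc-no-return (ℕ.s≤s⁻¹ i<)) (λ 1< → first-no-return parent₁ (ℕ.s≤s⁻¹ 1<)) u₁≢u₂ R-no-return
      at-root : ∀ {u} → d x u ≡ k → anc x u k ≡ x
      at-root {u} eq = sym (d≡0⇒≡ (trans (d-anc x u k) (trans (cong (_∸ k) eq) (ℕ.n∸n≡0 k))))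
      closed : walk 0 ≡ walk K
      closed = trans (at-root refl)
        (sym (trans (prepend-+ {P = anc x u₁} {R} (suc k) (suc k)) (at-root (sym level))))

    tailed : Tailed a b c e
    tailed = record
      { pendant = pendant
      ; parent-unique = λ {x} {y} {u₁} {u₂} tx ty p₁ p₂ → Dec.decidable-stable (u₁ Fin.≟ u₂)
          (λ u₁≢u₂ → acyclic (two-parents⇒cycle tx ty (record { parent₁ = p₁ ; parent₂ = p₂ ; u₁≢u₂ = u₁≢u₂ })))
      }

  -- The tree is the subgraph induced on all vertices but `b`, `c`, `e`, indexed by their
  -- complement; `n≡` identifies its order with `n ∸ 3`.
  tailed⇒union : ∀ {a b c e} → Tailed a b c e → ∃ λ (T : Graph (n ∸ 3)) → IsTree T × UnionSharingVertex G C₄ T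
  tailed⇒union {a} {b} {c} {e} t =
    subst (λ k → ∃ λ (T : Graph k) → IsTree T × UnionSharingVertex G C₄ T)
      (sym (trans (cong (_∸ 3) n≡) (ℕ.m+n∸m≡n 3 r)))
      (T , (connected , acyclic) , record
        { f = corner↣ ; g = mk↣ {to = ρ} inj
        ; vertex-union = vertex-union ; edge-union = λ u v → mk⇔ (to-union u v) (from-union u v)
        ; shared-vertex = a , ((zero , refl) , (t₀ , ρt₀≡a)) ,
            λ ((i , ci≡y) , s∈) → trans (sym (cong corner (corner-tail i ci≡y s∈))) ci≡y
        ; no-shared-edge = λ { u v ((i , j , ij , ci≡u , cj≡v) , (s , s′ , _ , ρs≡u , ρs′≡v)) →
            irrefl C₄ (subst₂ (Adj C₄) (corner-tail i ci≡u (s , ρs≡u)) (corner-tail j cj≡v (s′ , ρs′≡v)) ij) }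
        })
    where
    open Tailed t
    open PendantGeometry pendant
    module S = Square square
    unique = vertices-unique square
    unique-bce : Unique (b ∷ c ∷ e ∷ [])
    unique-bce = AllPairs.tail unique
    open Complement (complement unique-bce)

    T : Graph r
    T = record
      { Adj    = λ s t → Adj G (ρ s) (ρ t)
      ; adj?   = λ s t → adj? G (ρ s) (ρ t)
      ; symm   = symm G
      ; irrefl = irrefl G
      }

    ρ-tail : ∀ i → Tail (ρ i)
    ρ-tail i = avoid i ∘ here , avoid i ∘ there ∘ here , avoid i ∘ there ∘ there ∘ here

    cover-tail : ∀ {v} → Tail v → ∃ λ i → ρ i ≡ v
    cover-tail (v≢b , v≢c , v≢e) = cover λ
      { (here eq) → v≢b eq ; (there (here eq)) → v≢c eq ; (there (there (here eq))) → v≢e eq }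

    t₀ = proj₁ (cover-tail a-tail)
    ρt₀≡a = proj₂ (cover-tail a-tail)

    corner : Fin 4 → V
    corner = lookup (vertices a b c e)

    corner↣ : Fin 4 ↣ V
    corner↣ = mk↣ {to = corner} (lookup-unique unique)

    -- This yields both that `a` is the only shared vertex and that no edge is shared, since such an
    -- edge would be a loop of `C₄`.
    corner-tail : ∀ i {v} → corner i ≡ v → (∃ λ s → ρ s ≡ v) → i ≡ zero
    corner-tail zero                   _    _          = refl
    corner-tail (suc i) refl (s , ρs≡) = contradiction (subst (_∈ b ∷ c ∷ e ∷ []) (sym ρs≡) (∈-lookup i)) (avoid s)

    to-root : ∀ k s → d a (ρ s) ≡ k → Walk T s t₀
    to-root zero    s eq with refl ← inj (trans (sym (d≡0⇒≡ eq)) (sym ρt₀≡a)) = ε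
    to-root (suc k) s eq with cover-tail (par-tail a-tail (ρ-tail s))
    ... | s′ , ρs′≡ = subst (Adj G (ρ s)) (sym ρs′≡) (symm G (par-adj pos)) ◅
      to-root k s′ (trans (cong (d a) ρs′≡) (ℕ.suc-injective (trans (sym (par-rise pos)) eq)))
      where
      pos : 0 < d a (ρ s)
      pos = subst (0 <_) (sym eq) (s≤s z≤n)

    connected : Connected T
    connected s s′ = to-root _ s refl ◅◅ Star.reverse (symm T) (to-root _ s′ refl)

    -- On a cycle, consider a vertex farthest from `a`. By parity both its cycle neighbours are
    -- strictly nearer, which makes them two distinct parents.
    acyclic : ¬ CycleIn T
    acyclic z with farthest (λ i → d a (ρ (Injection.to (CycleIn.vertices z) i)))
    ... | i , max with cycle-neighbours i
    ...   | j , k , j≢k , ij , ik = j≢k (Injection.injective (CycleIn.vertices z)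
      (inj (parent-unique a-tail (ρ-tail _) (closer-neighbour ij) (closer-neighbour ik))))
      where
      z-vertex = ρ ∘ Injection.to (CycleIn.vertices z)
      closer-neighbour : ∀ {j} → Adj (cycle (CycleIn.ℓ z)) i j → Parent a (z-vertex j) (z-vertex i)
      closer-neighbour {j} ij with adj-step a (symm G (CycleIn.adjacent z ij))
      ... | inj₁ rise = symm G (CycleIn.adjacent z ij) , rise
      ... | inj₂ fall = contradiction (max j) (ℕ.<⇒≱ (ℕ.≤-reflexive (sym fall)))

    vertex-union : ∀ v → VertexOf corner↣ v ⊎ (∃ λ s → ρ s ≡ v)
    vertex-union v with v Fin.≟ b | v Fin.≟ c | v Fin.≟ e
    ... | yes v≡b | _       | _       = inj₁ (suc zero , sym v≡b)
    ... | no _    | yes v≡c | _       = inj₁ (suc (suc zero) , sym v≡c)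
    ... | no _    | no _    | yes v≡e = inj₁ (suc (suc (suc zero)) , sym v≡e)
    ... | no v≢b  | no v≢c  | no v≢e  = inj₂ (cover-tail (v≢b , v≢c , v≢e))

    square-edge : ∀ {u v} → SquareEdge a b c e u v → EdgeOf C₄ corner↣ u v
    square-edge ab = zero , suc zero , inj₁ (inj₁ refl) , refl , refl
    square-edge ba = suc zero , zero , inj₂ (inj₁ refl) , refl , refl
    square-edge bc = suc zero , suc (suc zero) , inj₁ (inj₁ refl) , refl , refl
    square-edge cb = suc (suc zero) , suc zero , inj₂ (inj₁ refl) , refl , refl
    square-edge ce = suc (suc zero) , suc (suc (suc zero)) , inj₁ (inj₁ refl) , refl , refl
    square-edge ec = suc (suc (suc zero)) , suc (suc zero) , inj₂ (inj₁ refl) , refl , refl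
    square-edge ea = suc (suc (suc zero)) , zero , inj₁ (inj₂ (refl , refl)) , refl , refl
    square-edge ae = zero , suc (suc (suc zero)) , inj₂ (inj₂ (refl , refl)) , refl , refl

    to-union : ∀ u v → Adj G u v → EdgeOf C₄ corner↣ u v ⊎ EdgeOf T (mk↣ {to = ρ} inj) u v
    to-union u v uv with edge-cases uv
    ... | inj₂ s = inj₁ (square-edge s)
    ... | inj₁ (tu , tv) with cover-tail tu | cover-tail tv
    ...   | s , refl | s′ , refl = inj₂ (s , s′ , uv , refl , refl)

    turn-edge : ∀ i → Adj G (corner i) (corner (turn i))
    turn-edge zero                   = S.ab
    turn-edge (suc zero)             = S.bc
    turn-edge (suc (suc zero))       = S.ce
    turn-edge (suc (suc (suc zero))) = S.ea

    from-union : ∀ u v → EdgeOf C₄ corner↣ u v ⊎ EdgeOf T (mk↣ {to = ρ} inj) u v → Adj G u v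
    from-union _ _ (inj₂ (_ , _ , st , refl , refl)) = st
    from-union _ _ (inj₁ (i , j , ij , refl , refl)) with turn-neighbour i j ij
    ... | inj₁ refl = turn-edge i
    ... | inj₂ refl = symm G $
      subst (Adj G (corner (turn (turn (turn i)))) ∘ corner) (turn⁴ i) (turn-edge (turn (turn (turn i))))

  -- The bound and the case of equality

  find-square : Dec (∃ λ a → ∃ λ b → ∃ λ c → ∃ λ e → Square a b c e)
  find-square = Fin.any? λ a → Fin.any? λ b → Fin.any? λ c → Fin.any? λ e → square? a b c e

  totalExcess-no-square : (∀ {a b c e} → ¬ Square a b c e) → n ≤ size G → 8 ℕ.* n ≤ totalExcess
  totalExcess-no-square no-square n≤m = begin
    8 ℕ.* n      ≡⟨ ℕ.*-comm 8 n ⟩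
    n ℕ.* 8      ≡⟨ sum-const n 8 ⟨
    ∑[ x < n ] 8 ≤⟨ sum-mono {n} (λ x → excess-no-square no-square x n≤m) ⟩
    totalExcess  ∎
    where open ≤-Reasoning

  totalExcess-bound : n ≤ size G → 8 ℕ.* n ≤ totalExcess + 16
  totalExcess-bound n≤m with find-square
  ... | yes (_ , _ , _ , _ , s) = SplitExcess.totalExcess-lower s
  ... | no none                 = ℕ.≤-trans (totalExcess-no-square (λ s → none (_ , _ , _ , _ , s)) n≤m) (ℕ.m≤m+n _ 16)

  -- As `totalExcess-bound` is the opposite inequality, `totalExcess + 16 ≤ 8 n` expresses equality
  -- without subtraction.
  extremal⇔union : n ≤ size G → totalExcess + 16 ≤ 8 ℕ.* n ⇔
    (∃ λ (T : Graph (n ∸ 3)) → IsTree T × UnionSharingVertex G C₄ T)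
  extremal⇔union n≤m = mk⇔ to from
    where
    to : totalExcess + 16 ≤ 8 ℕ.* n → ∃ λ (T : Graph (n ∸ 3)) → IsTree T × UnionSharingVertex G C₄ T
    to tight with find-square
    ... | yes (_ , _ , _ , _ , s) = tailed⇒union (proj₂ (proj₂ (proj₂ (proj₂ (extremal⇒tailed s tight)))))
    -- Without 4-cycles the total is at least `8 n`, so it misses the minimum by 16.
    ... | no none                 = contradiction
      (ℕ.≤-trans tight (totalExcess-no-square (λ s → none (_ , _ , _ , _ , s)) n≤m)) (ℕ.m+1+n≰m totalExcess)
    from : (∃ λ (T : Graph (n ∸ 3)) → IsTree T × UnionSharingVertex G C₄ T) → totalExcess + 16 ≤ 8 ℕ.* n
    from (_ , (_ , acyclic) , U) = tailed⇒extremal (UnionGeometry.tailed acyclic U)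

-- Integer differences

open import Data.Integer.Base using (+_; _-_; _*_; _≥_)

module _ (a b c d : ℕ) where

  private
    add-back : ∀ x y z → (x - y) ℤ.+ (y ℤ.+ z) ≡ x ℤ.+ z
    add-back = ℤ-Solver.solve-∀
    take-away : ∀ x y z → (x ℤ.+ z) ℤ.+ ℤ.- (y ℤ.+ z) ≡ x - y
    take-away = ℤ-Solver.solve-∀

  difference-≤ : a + d ≤ c + b → + a - + b ℤ.≤ + c - + d
  difference-≤ le = subst₂ ℤ._≤_ (take-away (+ a) (+ b) (+ d))
    (trans (cong (λ k → + (c + b) ℤ.+ ℤ.- k) (ℤ.+-comm (+ b) (+ d))) (take-away (+ c) (+ d) (+ b)))
    (ℤ.+-monoˡ-≤ (ℤ.- (+ b ℤ.+ + d)) (ℤ.+≤+ le))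

  difference-≤⁻ : + a - + b ℤ.≤ + c - + d → a + d ≤ c + b
  difference-≤⁻ le = ℤ.drop‿+≤+ (subst₂ ℤ._≤_ (add-back (+ a) (+ b) (+ d))
    (trans (cong (λ k → (+ c - + d) ℤ.+ k) (ℤ.+-comm (+ b) (+ d))) (add-back (+ c) (+ d) (+ b)))
    (ℤ.+-monoˡ-≤ (+ b ℤ.+ + d) le))

theorem2p3 : ∀ (n : ℕ) (G : Graph n) (conn : Connected G) → Bipartite G →
    n ℕ.≥ 4 → size G ℕ.≥ n →
    (+ szeged G conn - + wiener G conn ≥ + 4 * + n - + 8)
    × ((+ szeged G conn - + wiener G conn ≡ + 4 * + n - + 8)
    ⇔ (∃ λ (T : Graph (n ∸ 3)) → IsTree T × UnionSharingVertex G C₄ T))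
theorem2p3 n G conn bip _ n≤m = subst (λ k → k - + 8 ℤ.≤ + Sz - + W) (ℤ.pos-* 4 n) lower , mk⇔
  (λ eq → Equivalence.to (extremal⇔union n≤m) (extremal (ℤ.≤-reflexive
    (trans eq (cong (_- + 8) (sym (ℤ.pos-* 4 n)))))))
  (λ union → trans (ℤ.≤-antisym (upper (Equivalence.from (extremal⇔union n≤m) union)) lower)
    (cong (_- + 8) (ℤ.pos-* 4 n)))
  where
  open BipartiteMetric G conn bip
  open ≤-Reasoning
  Sz = szeged G conn
  W = wiener G conn

  double-lower : 2 ℕ.* (4 ℕ.* n + W) ≡ 8 ℕ.* n + 2 ℕ.* W
  double-lower = lemma n W
    where
    lemma : ∀ n w → 2 ℕ.* (4 ℕ.* n + w) ≡ 8 ℕ.* n + 2 ℕ.* w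
    lemma = solve-∀

  -- The constant 8 turns into 16 because `totalExcess` runs over ordered pairs.
  double-upper : 2 ℕ.* (Sz + 8) ≡ (totalExcess + 16) + 2 ℕ.* W
  double-upper = trans (ℕ.*-distribˡ-+ 2 Sz 8) (trans (cong (_+ 16) szeged-wiener) (lemma (2 ℕ.* W) totalExcess))
    where
    lemma : ∀ w k → w + k + 16 ≡ k + 16 + w
    lemma = solve-∀

  lower : + (4 ℕ.* n) - + 8 ℤ.≤ + Sz - + W
  lower = difference-≤ (4 ℕ.* n) 8 Sz W (ℕ.*-cancelˡ-≤ 2 (begin
    2 ℕ.* (4 ℕ.* n + W)              ≡⟨ double-lower ⟩
    8 ℕ.* n + 2 ℕ.* W                ≤⟨ ℕ.+-monoˡ-≤ (2 ℕ.* W) (totalExcess-bound n≤m) ⟩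
    (totalExcess + 16) + 2 ℕ.* W     ≡⟨ double-upper ⟨
    2 ℕ.* (Sz + 8)                   ∎))

  upper : totalExcess + 16 ≤ 8 ℕ.* n → + Sz - + W ℤ.≤ + (4 ℕ.* n) - + 8
  upper tight = difference-≤ Sz W (4 ℕ.* n) 8 (ℕ.*-cancelˡ-≤ 2 (begin
    2 ℕ.* (Sz + 8)                   ≡⟨ double-upper ⟩
    (totalExcess + 16) + 2 ℕ.* W     ≤⟨ ℕ.+-monoˡ-≤ (2 ℕ.* W) tight ⟩
    8 ℕ.* n + 2 ℕ.* W                ≡⟨ double-lower ⟨
    2 ℕ.* (4 ℕ.* n + W)              ∎))

  extremal : + Sz - + W ℤ.≤ + (4 ℕ.* n) - + 8 → totalExcess + 16 ≤ 8 ℕ.* n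
  extremal le = ℕ.+-cancelʳ-≤ (2 ℕ.* W) _ _ (begin
    (totalExcess + 16) + 2 ℕ.* W     ≡⟨ double-upper ⟨
    2 ℕ.* (Sz + 8)                   ≤⟨ ℕ.*-monoʳ-≤ 2 (difference-≤⁻ Sz W (4 ℕ.* n) 8 le) ⟩
    2 ℕ.* (4 ℕ.* n + W)              ≡⟨ double-lower ⟩
    8 ℕ.* n + 2 ℕ.* W                ∎)
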